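{- For every positive integer $m$, the Ruzsa number satisfies $R_m \le 192$.
   Context: For a positive integer $m$, let $\mathbb{Z}_m=\mathbb{Z}/m\mathbb{Z}$. For $A\subseteq \mathbb{Z}_m$ and $n\in\mathbb{Z}_m$, let $\sigma_A(n)$ denote the number of ordered pairs $(x,y)\in A\times A$ with $x+y=n$ in $\mathbb{Z}_m$. The Ruzsa number $R_m$ is the least positive integer $r$ such that there exists a set $A\subseteq\mathbb{Z}_m$ with $1\le \sigma_A(n)\le r$ for all $n\in\mathbb{Z}_m$. -}

module Defs where

open import Data.Nat using (ℕ; suc; _+_; _≤_; _%_; NonZero)
open import Data.Fin using (Fin; toℕ; fromℕ<)
open import Data.Fin.Subset using (Subset; _∈_)
open import Data.Fin.Subset.Properties using (_∈?_)
open import Data.Nat.Properties using (_≟_)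
open import Data.List using (List; length; filter; cartesianProduct; allFin)
open import Data.Product using (_×_; _,_; Σ; ∃)
open import Relation.Nullary.Decidable using (_×-dec_)
open import Relation.Binary.PropositionalEquality using (_≡_)

addMod : {m : ℕ} → Fin m → Fin m → ℕ
addMod {suc k} x y = (toℕ x + toℕ y) % suc k

σ : {m : ℕ} → Subset m → Fin m → ℕ
σ {m} A n = length (filter (λ p → (Data.Product.proj₁ p ∈? A)
                                ×-dec ((Data.Product.proj₂ p ∈? A)
                                ×-dec (addMod (Data.Product.proj₁ p) (Data.Product.proj₂ p) ≟ toℕ n)))
                           (cartesianProduct (allFin m) (allFin m)))

RuzsaAdmissible : ℕ → ℕ → Set
RuzsaAdmissible m r = ∃ λ (A : Subset m) → ∀ (n : Fin m) → 1 ≤ σ A n × σ A n ≤ r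

-- "R_m ≤ b": the least admissible r is at most b, i.e. some r ≤ b is admissible.
RuzsaNumberAtMost : ℕ → ℕ → Set
RuzsaNumberAtMost m b = ∃ λ r → 1 ≤ r × r ≤ b × RuzsaAdmissible m r

{-# OPTIONS --safe #-}
module Submission where

{-
Modulo a prime p, the curves y = κ x² with κ ∈ {g(g+1), 2g, g+1}, g a quadratic nonresidue, represent
every (s , t) as (x + x′ , y + y′): the discriminants for the pairs (2g , 2g) and (g(g+1) , g+1) are
gD and D up to squares, with D = t - g s², so one of them is a square. For each pair (κ , κ′) there
are at most two representations, and at most four for the three pairs just used, as D = 0 if both
kinds occur; this makes at most 6 · 2 + 4 = 16.

These points are lifted to the integers L x + y, with 0 ≤ x < X and 0 ≤ y < Y = p + L/2. Every residue
class of x or y then has several lifts. A sum s = x + x′ is reached by all residues of x when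
p - 1 ≤ s ≤ 2X - 1 - p, and likewise for y, so the sums fill an interval of length m when X is about
p + m/2L. Conversely, a class modulo m meets at most two sums n and n + m; carries in the low digit
account for a factor 3 = ⌈u⌉ + ⌈2 - u⌉ and the choice between n and n + m for a factor 4, and
16 · 3 · 4 = 192.

Since L may be 2p or 4p, this covers m from about 4p² to 24p², so it is enough to find primes in
intervals (n , 12n/5]. For large n these exist because 4ʲ ≤ Ψ(2j+1), where Ψ(N) = lcm(1, …, N), while
without such a prime Ψ(N) ≤ N^√N · 4ⁿ for N close to 12n/5.
-}

open import Defs
open import Data.Nat using (ℕ; _≤_)

-- The curves live modulo p, while m has no structure at all. Writing elements as L x + y moves the
-- problem to the integers, where covering asks for long digit ranges and counting for short ones.
-- The choice 2Y = L + 2p balances the two: the low sums p - 1, ..., 2Y - 1 - p just include L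
-- consecutive values, while for a low residue t the summand y has at most t + 1 = u p choices
-- without a carry and 2Y - L - (t + 1) = (2 - u) p, if positive, with one; this is the u of the
-- count above. The high digit is treated alike, with m/L in the place of L and the sums n and n + m
-- in the place of the two carries.
--
-- Y ≤ L keeps digits unique and Y ≤ 3p allows three lifts at most; with Y = p + L/2 this means 2p ≤
-- L ≤ 4p, and the overview takes the two extremes. The high digit needs 2p < m/L ≤ 6p. One prime
-- thus serves a ratio of about 6 in m, hence √6 = 2.449... in p; the fraction 12/5 lies below it,
-- and the margin absorbs lower-order terms.

module LinearArithmetic where
  open import Data.Nat
  open import Data.Nat.Properties
  open import Relation.Binary.PropositionalEquality

  -- x ≤ y is a sum of hypotheses and k the slack, so that the last argument is a ring identity.
  by≤ : ∀ {x y a b} k → x ≤ y → a + y + k ≡ b + x → a ≤ b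
  by≤ {x} {y} {a} {b} k x≤y eq = +-cancelʳ-≤ x a b
    (≤-trans (+-monoʳ-≤ a x≤y) (≤-trans (m≤m+n (a + y) k) (≤-reflexive eq)))

  infixr 6 _⊕_
  infixr 7 _⊛_

  _⊕_ : ∀ {a b c d} → a ≤ b → c ≤ d → a + c ≤ b + d
  _⊕_ = +-mono-≤

  _⊛_ : ∀ {a b} k → a ≤ b → k * a ≤ k * b
  k ⊛ a≤b = *-monoʳ-≤ k a≤b

  =≤ : ∀ {a b : ℕ} → a ≡ b → a ≤ b
  =≤ = ≤-reflexive

  ≥= : ∀ {a b : ℕ} → a ≡ b → b ≤ a
  ≥= e = ≤-reflexive (sym e)

-- Primes in the intervals (n, 12n/5], by Chebyshev's method

module PrimeGaps where
  open LinearArithmetic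
  open import Data.Nat
  open import Data.Nat.Properties
  open import Data.Nat.Divisibility
  open import Data.Nat.Primality
  open import Data.Nat.Combinatorics using (_C_; nCk≡n!/k![n-k]!; k![n∸k]!∣n!; nCk+nC[k+1]≡[n+1]C[k+1])
  open import Data.Nat.DivMod using (m/n*n≡m; m%n<n)
  open import Data.Nat.Coprimality using (Coprime; coprime-divisor)
  open import Data.Nat.Induction using (<-rec)
  open import Data.Product using (∃; ∃₂; _×_; _,_; proj₁; proj₂)
  open import Data.Sum using (_⊎_; inj₁; inj₂)
  open import Data.Empty using (⊥; ⊥-elim)
  open import Function using (case_of_)
  open import Level using (0ℓ)
  open import Relation.Unary using (Pred; Decidable)
  open import Relation.Nullary using (¬_; Dec; yes; no; contradiction)
  open import Relation.Nullary.Decidable using (True; toWitness)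
  open import Relation.Binary.PropositionalEquality
  open import Data.Nat.Tactic.RingSolver using (solve-∀)

  lastTrue : (P : Pred ℕ 0ℓ) → Decidable P → P 0 → ∀ b → ¬ P b → ∃ λ k → k < b × P k × ¬ P (suc k)
  lastTrue P P? P0 zero    ¬Pb = contradiction P0 ¬Pb
  lastTrue P P? P0 (suc b) ¬Pb with P? b
  ... | yes Pb = b , ≤-refl , Pb , ¬Pb
  ... | no ¬P′ with lastTrue P P? P0 b ¬P′
  ...   | k , k<b , Pk , ¬Psk = k , m<n⇒m<1+n k<b , Pk , ¬Psk

  n<q^n : ∀ {q} → 2 ≤ q → ∀ n → n < q ^ n
  n<q^n 2≤q zero = ≤-refl
  n<q^n {q} 2≤q (suc n) = ≤-trans (by≤ n (2 ⊛ n<q^n 2≤q n) (lem n (q ^ n))) (*-monoˡ-≤ (q ^ n) 2≤q)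
    where lem : ∀ n a → suc (suc n) + 2 * a + n ≡ 2 * a + 2 * suc n
          lem = solve-∀

  floorLog : ∀ q → 2 ≤ q → ∀ n → 1 ≤ n → ∃ λ e → q ^ e ≤ n × n < q ^ suc e
  floorLog q 2≤q n 1≤n with lastTrue (λ e → q ^ e ≤ n) (λ e → q ^ e ≤? n) 1≤n n (<⇒≱ (n<q^n 2≤q n))
  ... | e , _ , le , nle = e , le , ≰⇒> nle

  floorSqrt : ∀ n → ∃ λ r → r * r ≤ n × n < suc r * suc r
  floorSqrt n with lastTrue (λ r → r * r ≤ n) (λ r → r * r ≤? n) z≤n (suc n) (<⇒≱ (m≤m*n (suc n) (suc n)))
  ... | r , _ , le , nle = r , le , ≰⇒> nle

  -- Binomial coefficients and the Leibniz harmonic triangle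

  C-fact : ∀ i j → ((i + j) C i) * (i ! * j !) ≡ (i + j) !
  C-fact i j = begin
    ((i + j) C i) * (i ! * j !)               ≡⟨ cong (λ z → ((i + j) C i) * (i ! * z !)) (m+n∸m≡n i j) ⟨
    ((i + j) C i) * (i ! * (i + j ∸ i) !)     ≡⟨ cong (_* (i ! * (i + j ∸ i) !)) (nCk≡n!/k![n-k]! (m≤m+n i j)) ⟩
    ((i + j) ! / (i ! * (i + j ∸ i) !)) * (i ! * (i + j ∸ i) !) ≡⟨ m/n*n≡m (k![n∸k]!∣n! (m≤m+n i j)) ⟩
    (i + j) !  ∎
    where
    open ≡-Reasoning
    instance _ = i !* (i + j ∸ i) !≢0

  -- After multiplication by i! j! both sides are the factorial of i + j + 1. The symmetric
  -- arguments i and j avoid truncated subtraction.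
  C-absorbˡ : ∀ i j → suc i * ((suc i + j) C suc i) ≡ suc (i + j) * ((i + j) C i)
  C-absorbˡ i j = *-cancelʳ-≡ _ _ (i ! * j !) (begin
    suc i * ((suc i + j) C suc i) * (i ! * j !)     ≡⟨ lem (suc i) ((suc i + j) C suc i) (i !) (j !) ⟩
    ((suc i + j) C suc i) * (suc i * i ! * j !)     ≡⟨ C-fact (suc i) j ⟩
    suc (i + j) * (i + j) !                          ≡⟨ cong (suc (i + j) *_) (C-fact i j) ⟨
    suc (i + j) * (((i + j) C i) * (i ! * j !))     ≡⟨ *-assoc (suc (i + j)) ((i + j) C i) (i ! * j !) ⟨
    suc (i + j) * ((i + j) C i) * (i ! * j !)       ∎)
    where
    open ≡-Reasoning
    instance _ = i !* j !≢0
    lem : ∀ a b c d → a * b * (c * d) ≡ b * (a * c * d)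
    lem = solve-∀

  C-absorbʳ : ∀ i j → suc j * ((i + suc j) C i) ≡ suc (i + j) * ((i + j) C i)
  C-absorbʳ i j = *-cancelʳ-≡ _ _ (i ! * j !) (begin
    suc j * ((i + suc j) C i) * (i ! * j !)         ≡⟨ lem (suc j) ((i + suc j) C i) (i !) (j !) ⟩
    ((i + suc j) C i) * (i ! * (suc j * j !))       ≡⟨ C-fact i (suc j) ⟩
    (i + suc j) !                                    ≡⟨ cong _! (+-suc i j) ⟩
    suc (i + j) * (i + j) !                          ≡⟨ cong (suc (i + j) *_) (C-fact i j) ⟨
    suc (i + j) * (((i + j) C i) * (i ! * j !))     ≡⟨ *-assoc (suc (i + j)) ((i + j) C i) (i ! * j !) ⟨
    suc (i + j) * ((i + j) C i) * (i ! * j !)       ∎)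
    where
    open ≡-Reasoning
    instance _ = i !* j !≢0
    lem : ∀ a b c d → a * b * (c * d) ≡ b * (c * (a * d))
    lem = solve-∀

  -- Pascal's rule doubles the bound from row to row. Starting at row 1, whose entries are at most
  -- 1, gains the factor 2 that `midC-upper` relies on.
  C-upper : ∀ n k → suc n C k ≤ 2 ^ n
  C-upper n       zero    = m^n>0 2 n
  C-upper zero    (suc zero) = ≤-refl
  C-upper zero    (suc (suc k)) = z≤n
  C-upper (suc n) (suc k) = begin
    suc (suc n) C suc k               ≡⟨ nCk+nC[k+1]≡[n+1]C[k+1] (suc n) k ⟨
    suc n C k + suc n C suc k         ≤⟨ C-upper n k ⊕ C-upper n (suc k) ⟩
    2 ^ n + 2 ^ n                     ≡⟨ cong (2 ^ n +_) (+-identityʳ (2 ^ n)) ⟨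
    2 ^ suc n ∎
    where open ≤-Reasoning

  -- One of the two equal middle entries of row 2k + 1; their sum is the central entry of the next
  -- row.
  midC : ℕ → ℕ
  midC k = (k + suc k) C k

  midC-sym : ∀ k → (suc k + k) C suc k ≡ midC k
  midC-sym k = *-cancelˡ-≡ _ _ (suc k) (trans (C-absorbˡ k k) (sym (C-absorbʳ k k)))

  midC-upper : ∀ k → midC k ≤ 4 ^ k
  midC-upper k = *-cancelˡ-≤ 2 (begin
    2 * midC k                                  ≡⟨ cong (midC k +_) (+-identityʳ (midC k)) ⟩
    midC k + midC k                             ≡⟨ cong (midC k +_) (midC-sym k) ⟨
    midC k + (suc k + k) C suc k                ≡⟨ cong (λ z → z C k + (suc k + k) C suc k) (+-suc k k) ⟩
    suc (k + k) C k + suc (k + k) C suc k       ≡⟨ nCk+nC[k+1]≡[n+1]C[k+1] (suc (k + k)) k ⟩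
    suc (suc (k + k)) C suc k                   ≤⟨ C-upper (suc (k + k)) (suc k) ⟩
    2 * 2 ^ (k + k)                             ≡⟨ cong (λ z → 2 * 2 ^ (k + z)) (+-identityʳ k) ⟨
    2 * 2 ^ (2 * k)                             ≡⟨ cong (2 *_) (^-*-assoc 2 2 k) ⟨
    2 * 4 ^ k ∎)
    where open ≤-Reasoning

  -- The denominators of the Leibniz harmonic triangle divide every common multiple of 1, …, n.
  leibniz : ∀ Λ i j → (∀ t → 1 ≤ t → t ≤ suc (i + j) → t ∣ Λ) → suc (i + j) * ((i + j) C i) ∣ Λ
  leibniz Λ zero j h = subst (_∣ Λ) (sym (*-identityʳ (suc j))) (h (suc j) (s≤s z≤n) ≤-refl)
  leibniz Λ (suc i) j h = *-cancelʳ-∣ (suc i) (subst (x * suc i ∣_) (*-comm (suc i) Λ) (∣m+n∣m⇒∣n d₃ d₂))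
    where
    b = (suc i + j) C suc i
    x = suc (suc i + j) * b
    ih₁ : suc i * b ∣ Λ
    ih₁ = subst (_∣ Λ) (sym (C-absorbˡ i j)) (leibniz Λ i j λ t 1≤t t≤ → h t 1≤t (m≤n⇒m≤1+n t≤))
    ih₂ : suc (suc i + j) * ((i + suc j) C i) ∣ Λ
    ih₂ = subst (λ z → suc z * ((i + suc j) C i) ∣ Λ) (+-suc i j)
            (leibniz Λ i (suc j) λ t 1≤t t≤ → h t 1≤t (subst (λ z → t ≤ suc z) (+-suc i j) t≤))
    -- With T(i , j) = (i + j + 1) (i + j choose i) the rule of the triangle is 1/T(i+1 , j) = 1/T(i
    -- , j) - 1/T(i , j+1). Cleared of fractions, it makes x (i + 1) divide (i + j + 2) Λ - (j + 1)
    -- Λ = (i + 1) Λ.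
    d₁ : x * suc i ∣ suc (suc i + j) * Λ
    d₁ = subst (_∣ suc (suc i + j) * Λ) (lem (suc (suc i + j)) (suc i) b) (*-monoʳ-∣ (suc (suc i + j)) ih₁)
      where lem : ∀ a c b → a * (c * b) ≡ a * b * c
            lem = solve-∀
    d₂ : x * suc i ∣ suc j * Λ
    d₂ = subst (_∣ suc j * Λ) eq (*-monoʳ-∣ (suc j) ih₂)
      where
      open ≡-Reasoning
      lem : ∀ a c b → a * (c * b) ≡ c * (a * b)
      lem = solve-∀
      lem′ : ∀ a c b → a * (c * b) ≡ a * b * c
      lem′ = solve-∀
      eq : suc j * (suc (suc i + j) * ((i + suc j) C i)) ≡ x * suc i
      eq = begin
        suc j * (suc (suc i + j) * ((i + suc j) C i)) ≡⟨ lem (suc j) (suc (suc i + j)) ((i + suc j) C i) ⟩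
        suc (suc i + j) * (suc j * ((i + suc j) C i)) ≡⟨ cong (suc (suc i + j) *_) (trans (C-absorbʳ i j) (sym (C-absorbˡ i j))) ⟩
        suc (suc i + j) * (suc i * b) ≡⟨ lem′ (suc (suc i + j)) (suc i) b ⟩
        x * suc i ∎
    d₃ : x * suc i ∣ suc j * Λ + suc i * Λ
    d₃ = subst (x * suc i ∣_) (lem i j Λ) d₁
      where lem : ∀ i j Λ → suc (suc i + j) * Λ ≡ suc j * Λ + suc i * Λ
            lem = solve-∀

  -- From j to j + 1 the right side grows by the factor (4j + 6) / (j + 1), which exceeds 4.
  central-lower : ∀ j → 4 ^ j ≤ suc (j + j) * ((j + j) C j)
  central-lower zero = ≤-refl
  central-lower (suc j) = *-cancelˡ-≤ (suc j) (begin
    suc j * (4 * 4 ^ j)                             ≤⟨ *-monoʳ-≤ (suc j) (*-monoʳ-≤ 4 (central-lower j)) ⟩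
    suc j * (4 * (suc (j + j) * c))                 ≤⟨ m≤m+n _ (2 * (suc (j + j) * c)) ⟩
    suc j * (4 * (suc (j + j) * c)) + 2 * (suc (j + j) * c) ≡⟨ lem₁ j c ⟩
    2 * suc (suc j + suc j) * (suc (j + j) * c)     ≡⟨ cong (2 * suc (suc j + suc j) *_) (C-absorbʳ j j) ⟨
    2 * suc (suc j + suc j) * (suc j * ((j + suc j) C j)) ≡⟨ lem₂ j ((j + suc j) C j) ⟩
    suc (suc j + suc j) * (suc (j + suc j) * ((j + suc j) C j)) ≡⟨ cong (suc (suc j + suc j) *_) (C-absorbˡ j (suc j)) ⟨
    suc (suc j + suc j) * (suc j * ((suc j + suc j) C suc j)) ≡⟨ lem₃ (suc (suc j + suc j)) (suc j) ((suc j + suc j) C suc j) ⟩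
    suc j * (suc (suc j + suc j) * ((suc j + suc j) C suc j)) ∎)
    where
    open ≤-Reasoning
    c = (j + j) C j
    lem₁ : ∀ j c → suc j * (4 * (suc (j + j) * c)) + 2 * (suc (j + j) * c) ≡ 2 * suc (suc j + suc j) * (suc (j + j) * c)
    lem₁ = solve-∀
    lem₂ : ∀ j d → 2 * suc (suc j + suc j) * (suc j * d) ≡ suc (suc j + suc j) * (suc (j + suc j) * d)
    lem₂ = solve-∀
    lem₃ : ∀ a b c → a * (b * c) ≡ b * (a * c)
    lem₃ = solve-∀

  -- Erdős's bound for the product of the primes up to n

  ∏ : (ℕ → ℕ) → ℕ → ℕ
  ∏ f zero    = 1
  ∏ f (suc n) = f (suc n) * ∏ f n

  primeOr1 : ℕ → ℕ
  primeOr1 q with prime? q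
  ... | yes _ = q
  ... | no _  = 1

  primorial : ℕ → ℕ
  primorial = ∏ primeOr1

  prime∤∏ : ∀ {p} → Prime p → ∀ n → n < p → p ∤ primorial n
  prime∤∏ pp zero n<p p∣ = contradiction (∣⇒≤ p∣) (<⇒≱ (nonTrivial⇒n>1 _ {{prime⇒nonTrivial pp}}))
  prime∤∏ {p} pp (suc n) n<p p∣ with prime? (suc n)
  ... | no _ = prime∤∏ pp n (<-trans ≤-refl n<p) (subst (p ∣_) (*-identityˡ _) p∣)
  ... | yes _ with euclidsLemma (suc n) (primorial n) pp p∣
  ...   | inj₁ d = contradiction (∣⇒≤ d) (<⇒≱ n<p)
  ...   | inj₂ d = prime∤∏ pp n (<-trans ≤-refl n<p) d

  prime∤⇒coprime : ∀ {p n} → Prime p → p ∤ n → Coprime p n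
  prime∤⇒coprime pp p∤n {d} (d∣p , d∣n) with prime⇒irreducible pp d∣p
  ... | inj₁ d≡1 = d≡1
  ... | inj₂ refl = contradiction d∣n p∤n

  coprime-∣ : ∀ {m n o} → Coprime m n → m ∣ o → n ∣ o → m * n ∣ o
  coprime-∣ {m} {n} cop m∣o (divides q refl) with coprime-divisor cop (subst (m ∣_) (*-comm q n) m∣o)
  ... | divides r refl = divides r (*-assoc r m n)

  prime∣!⇒≤ : ∀ {p} → Prime p → ∀ n → p ∣ n ! → p ≤ n
  prime∣!⇒≤ pp zero d = contradiction (∣⇒≤ d) (<⇒≱ (nonTrivial⇒n>1 _ {{prime⇒nonTrivial pp}}))
  prime∣!⇒≤ pp (suc n) d with euclidsLemma (suc n) (n !) pp d
  ... | inj₁ e = ∣⇒≤ e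
  ... | inj₂ e = m≤n⇒m≤1+n (prime∣!⇒≤ pp n e)

  ≤⇒∣! : ∀ {d} → 1 ≤ d → ∀ n → d ≤ n → d ∣ n !
  ≤⇒∣! {suc d} _ n le = ∣-trans (m∣m*n (d !)) (m≤n⇒m!∣n! le)

  -- Every prime in (k+1, 2k+1] divides the binomial coefficient.
  primorial-step : ∀ k i → i ≤ k → primorial (suc k + i) ∣ primorial (suc k) * midC k
  primorial-step k zero _ = subst (λ z → primorial z ∣ primorial (suc k) * midC k) (sym (+-identityʳ (suc k))) (m∣m*n (midC k))
  primorial-step k (suc i) i<k rewrite +-suc k i with prime? (suc (suc k + i))
  ... | no _ = subst (_∣ primorial (suc k) * midC k) (sym (*-identityˡ _)) (primorial-step k i (<⇒≤ i<k))
  ... | yes pp = coprime-∣ (prime∤⇒coprime pp (prime∤∏ pp _ ≤-refl)) (∣n⇒∣m*n (primorial (suc k)) p∣mid) (primorial-step k i (<⇒≤ i<k))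
    where
    p = suc (suc k + i)
    p∣prod : p ∣ midC k * (k ! * suc k !)
    p∣prod = subst (p ∣_) (sym (C-fact k (suc k))) (≤⇒∣! (s≤s z≤n) (k + suc k)
      (subst (_≤ k + suc k) (lem k i) (+-monoʳ-≤ k (s≤s i<k))))
      where lem : ∀ k i → k + suc (suc i) ≡ suc (suc k + i)
            lem = solve-∀
    p∣mid : p ∣ midC k
    p∣mid with euclidsLemma (midC k) (k ! * suc k !) pp p∣prod
    ... | inj₁ d = d
    ... | inj₂ d with euclidsLemma (k !) (suc k !) pp d
    ...   | inj₁ e = contradiction (prime∣!⇒≤ pp k e) (<⇒≱ (s≤s (≤-trans (m≤m+n k i) (n≤1+n _))))
    ...   | inj₂ e = contradiction (prime∣!⇒≤ pp (suc k) e) (<⇒≱ (s≤s (s≤s (m≤m+n k i))))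

  primorial>0 : ∀ n → 1 ≤ primorial n
  primorial>0 zero = ≤-refl
  primorial>0 (suc n) with prime? (suc n)
  ... | yes _ = *-mono-≤ (s≤s (z≤n {n})) (primorial>0 n)
  ... | no _  = *-mono-≤ (≤-refl {1}) (primorial>0 n)

  midC>0 : ∀ k → 1 ≤ midC k
  midC>0 k with midC k | C-fact k (suc k)
  ... | zero | eq = contradiction eq (≢-sym (m<n⇒n≢0 (1≤n! (k + suc k))))
  ... | suc _ | _ = s≤s z≤n

  even-or-odd : ∀ n → ∃ λ k → n ≡ k + k ⊎ n ≡ suc (k + k)
  even-or-odd zero = 0 , inj₁ refl
  even-or-odd (suc n) with even-or-odd n
  ... | k , inj₁ refl = k , inj₂ refl
  ... | k , inj₂ refl = suc k , inj₁ (cong suc (sym (+-suc k k)))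

  primorial-even : ∀ k → 2 ≤ k → primorial (k + k) ≡ primorial (pred (k + k))
  primorial-even (suc k) (s≤s 1≤k) with prime? (suc k + suc k)
  ... | no _ = *-identityˡ _
  ... | yes pp with prime⇒irreducible pp (divides (suc k) (lem k))
    where lem : ∀ k → suc k + suc k ≡ suc k * 2
          lem = solve-∀
  ...   | inj₁ ()
  ...   | inj₂ eq = contradiction (suc-injective eq) (<⇒≢ (+-mono-≤ 1≤k (s≤s (z≤n {k}))))

  -- Erdős's induction: an even n above 2 contributes no prime, and for n = 2k + 1 the primes above
  -- k + 1 contribute at most `midC k`, which leaves 4 ^ (k + 1) · 4 ^ k.
  primorial-upper : ∀ n → primorial n ≤ 4 ^ n
  primorial-upper = <-rec (λ n → primorial n ≤ 4 ^ n) step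
    where
    open ≤-Reasoning
    step : ∀ n → (∀ {m} → m < n → primorial m ≤ 4 ^ m) → primorial n ≤ 4 ^ n
    step n rec with even-or-odd n
    ... | zero , inj₁ refl = ≤-refl
    ... | suc zero , inj₁ refl = s≤s (s≤s z≤n)
    ... | zero , inj₂ refl = s≤s z≤n
    ... | suc (suc k) , inj₁ refl = begin
        primorial (suc (suc k) + suc (suc k)) ≡⟨ primorial-even (suc (suc k)) (s≤s (s≤s z≤n)) ⟩
        primorial (suc k + suc (suc k)) ≤⟨ rec ≤-refl ⟩
        4 ^ (suc k + suc (suc k)) ≤⟨ ^-monoʳ-≤ 4 (n≤1+n (suc k + suc (suc k))) ⟩
        4 ^ (suc (suc k) + suc (suc k)) ∎
    ... | suc k , inj₂ refl = begin
        primorial (suc (suc k + suc k)) ≤⟨ ∣⇒≤ {{>-nonZero (*-mono-≤ (primorial>0 (suc (suc k))) (midC>0 (suc k)))}} (primorial-step (suc k) (suc k) ≤-refl) ⟩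
        primorial (suc (suc k)) * midC (suc k) ≤⟨ *-mono-≤ (rec (s≤s (s≤s (≤-trans (s≤s (m≤m+n k k)) (≤-reflexive (sym (+-suc k k))))))) (midC-upper (suc k)) ⟩
        4 ^ suc (suc k) * 4 ^ suc k ≡⟨ ^-distribˡ-+-* 4 (suc (suc k)) (suc k) ⟨
        4 ^ suc (suc k + suc k) ∎

  -- The prime power factorisation of lcm(1, ..., N)

  primePower : ℕ → ℕ → ℕ
  primePower N q with prime? q | 1 ≤? N
  ... | yes pp | yes 1≤N = q ^ proj₁ (floorLog q (nonTrivial⇒n>1 q {{prime⇒nonTrivial pp}}) N 1≤N)
  ... | _      | _       = 1

  primePower≤N : ∀ N → 1 ≤ N → ∀ q → primePower N q ≤ N
  primePower≤N N 1≤N q with prime? q | 1 ≤? N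
  ... | yes pp | yes 1≤N′ = proj₁ (proj₂ (floorLog q (nonTrivial⇒n>1 q {{prime⇒nonTrivial pp}}) N 1≤N′))
  ... | yes _  | no _     = 1≤N
  ... | no _   | yes _    = 1≤N
  ... | no _   | no _     = 1≤N

  primePower-nonPrime : ∀ N q → ¬ Prime q → primePower N q ≡ 1
  primePower-nonPrime N q ¬pq with prime? q | 1 ≤? N
  ... | yes pq | _     = contradiction pq ¬pq
  ... | no _   | yes _ = refl
  ... | no _   | no _  = refl

  ^-≤-small : ∀ q {N} e → 2 ≤ q → q ^ e ≤ N → N < q * q → q ^ e ≤ q
  ^-≤-small q zero 2≤q _ _ = <⇒≤ 2≤q
  ^-≤-small q (suc zero) _ _ _ = ≤-reflexive (*-identityʳ q)
  ^-≤-small q@(suc _) (suc (suc e)) _ le N<qq =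
    contradiction (<-≤-trans N<qq (*-monoʳ-≤ q (m≤m*n q (q ^ e) {{m^n≢0 q e}}))) (≤⇒≯ le)

  primePower≤primeOr1 : ∀ N q → N < q * q → primePower N q ≤ primeOr1 q
  primePower≤primeOr1 N q N<qq with prime? q | 1 ≤? N
  ... | yes pp | yes 1≤N′ = ^-≤-small q (proj₁ (floorLog q 2≤q N 1≤N′)) 2≤q (proj₁ (proj₂ (floorLog q 2≤q N 1≤N′))) N<qq
    where 2≤q = nonTrivial⇒n>1 q {{prime⇒nonTrivial pp}}
  ... | yes pp | no _  = <⇒≤ (nonTrivial⇒n>1 q {{prime⇒nonTrivial pp}})
  ... | no _   | yes _ = ≤-refl
  ... | no _   | no _  = ≤-refl

  ^-≤⇒∣ : ∀ q {a b} → a ≤ b → q ^ a ∣ q ^ b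
  ^-≤⇒∣ q {a} {b} a≤b = subst (λ z → q ^ a ∣ q ^ z) (m+[n∸m]≡n a≤b)
    (subst (q ^ a ∣_) (sym (^-distribˡ-+-* q a (b ∸ a))) (m∣m*n (q ^ (b ∸ a))))

  ^∣primePower : ∀ N q e → Prime q → 1 ≤ N → q ^ e ≤ N → q ^ e ∣ primePower N q
  ^∣primePower N q e pp 1≤N le with prime? q | 1 ≤? N
  ... | no ¬pp | _ = contradiction pp ¬pp
  ... | yes _ | no ¬1≤N = contradiction 1≤N ¬1≤N
  ... | yes pp′ | yes 1≤N′ = ^-≤⇒∣ q {e} {proj₁ (floorLog q 2≤q N 1≤N′)} (≮⇒≥ λ k<e →
          <⇒≱ (proj₂ (proj₂ (floorLog q 2≤q N 1≤N′))) (≤-trans (^-monoʳ-≤ q {{prime⇒nonZero pp}} k<e) le))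
    where 2≤q = nonTrivial⇒n>1 q {{prime⇒nonTrivial pp′}}

  stripPower : ∀ q → 2 ≤ q → ∀ j → 1 ≤ j → ∃₂ λ e j′ → j ≡ q ^ e * j′ × 1 ≤ j′ × q ∤ j′
  stripPower q 2≤q = <-rec _ step
    where
    step : ∀ j → (∀ {i} → i < j → 1 ≤ i → ∃₂ λ e j′ → i ≡ q ^ e * j′ × 1 ≤ j′ × q ∤ j′) →
           1 ≤ j → ∃₂ λ e j′ → j ≡ q ^ e * j′ × 1 ≤ j′ × q ∤ j′
    step j rec 1≤j with q ∣? j
    ... | no q∤j = 0 , j , sym (*-identityˡ j) , 1≤j , q∤j
    ... | yes (divides zero refl) = contradiction 1≤j λ ()
    ... | yes (divides (suc i) refl) with rec (m<m*n (suc i) q 2≤q) (s≤s z≤n)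
    ...   | e , j′ , eq , 1≤j′ , q∤j′ = suc e , j′ , trans (cong (_* q) eq) (lem q (q ^ e) j′) , 1≤j′ , q∤j′
      where lem : ∀ q a b → a * b * q ≡ q * a * b
            lem = solve-∀

  primeDivisor : ∀ n → 2 ≤ n → ∃ λ p → Prime p × p ∣ n
  primeDivisor = <-rec _ step
    where
    step : ∀ n → (∀ {i} → i < n → 2 ≤ i → ∃ λ p → Prime p × p ∣ i) → 2 ≤ n → ∃ λ p → Prime p × p ∣ n
    step n rec 2≤n with prime? n
    ... | yes pn = n , pn , ∣-refl
    ... | no ¬pn with ¬prime⇒composite {{n>1⇒nonTrivial 2≤n}} ¬pn
    ...   | composite {d = d} d<n d∣n with rec d<n (nonTrivial⇒n>1 d)
    ...     | p , pp , p∣d = p , pp , ∣-trans p∣d d∣n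

  -- Induction on B: the part of j made of the prime B is a power of B below N, hence divides primePower N B.
  smooth∣∏ : ∀ N B j → 1 ≤ j → j ≤ N → (∀ p → Prime p → p ∣ j → p ≤ B) → j ∣ ∏ (primePower N) B
  smooth∣∏ N zero j 1≤j j≤N h with j ≤? 1
  ... | yes j≤1 = subst (_∣ 1) (≤-antisym 1≤j j≤1) ∣-refl
  ... | no j≰1 with primeDivisor j (≰⇒> j≰1)
  ...   | p , pp , p∣j = contradiction (h p pp p∣j) (<⇒≱ (<-trans (s≤s z≤n) (nonTrivial⇒n>1 p {{prime⇒nonTrivial pp}})))
  smooth∣∏ N (suc B) j 1≤j j≤N h = go (prime? (suc B))
    where
    drop : ∀ {i} → (suc B ∣ i → ¬ Prime (suc B)) → (∀ p → p ∣ i → p ∣ j) → ∀ p → Prime p → p ∣ i → p ≤ B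
    drop ¬d i∣j p pp p∣i with m≤n⇒m<n∨m≡n (h p pp (i∣j p p∣i))
    ... | inj₁ (s≤s p≤B) = p≤B
    ... | inj₂ refl = contradiction pp (¬d p∣i)
    go : Dec (Prime (suc B)) → j ∣ ∏ (primePower N) (suc B)
    go (no ¬p) = ∣n⇒∣m*n (primePower N (suc B)) (smooth∣∏ N B j 1≤j j≤N (drop (λ _ → ¬p) (λ _ p∣j → p∣j)))
    go (yes ps) with stripPower (suc B) (nonTrivial⇒n>1 _ {{prime⇒nonTrivial ps}}) j 1≤j
    ... | e , i , j≡ , 1≤i , ∤ = subst (_∣ ∏ (primePower N) (suc B)) (sym j≡) (*-pres-∣
      (^∣primePower N (suc B) e ps (≤-trans 1≤j j≤N)
        (≤-trans (m≤m*n (suc B ^ e) i {{>-nonZero 1≤i}}) qᵉi≤N))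
      (smooth∣∏ N B i 1≤i (≤-trans (m≤n*m i (suc B ^ e) {{m^n≢0 (suc B) e}}) qᵉi≤N)
        (drop (λ d → contradiction d ∤) λ p p∣i → subst (p ∣_) (sym j≡) (∣n⇒∣m*n (suc B ^ e) p∣i))))
      where
      qᵉi≤N : suc B ^ e * i ≤ N
      qᵉi≤N = subst (_≤ N) j≡ j≤N

  -- As a product over all q ≤ N, the least common multiple can be bounded above factor by factor;
  -- the lower bound uses it through `∣Ψ`.
  Ψ : ℕ → ℕ
  Ψ N = ∏ (primePower N) N

  ∣Ψ : ∀ N t → 1 ≤ t → t ≤ N → t ∣ Ψ N
  ∣Ψ N t 1≤t t≤N = smooth∣∏ N N t 1≤t t≤N λ p pp p∣t → ≤-trans (∣⇒≤ {{>-nonZero 1≤t}} p∣t) t≤N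

  primePower>0 : ∀ N q → 1 ≤ primePower N q
  primePower>0 N q with prime? q | 1 ≤? N
  ... | yes pp | yes 1≤N = m^n>0 q {{prime⇒nonZero pp}} (proj₁ (floorLog q (nonTrivial⇒n>1 q {{prime⇒nonTrivial pp}}) N 1≤N))
  ... | yes _  | no _     = ≤-refl
  ... | no _   | yes _    = ≤-refl
  ... | no _   | no _     = ≤-refl

  ∏>0 : ∀ f → (∀ q → 1 ≤ f q) → ∀ n → 1 ≤ ∏ f n
  ∏>0 f h zero = ≤-refl
  ∏>0 f h (suc n) = *-mono-≤ (h (suc n)) (∏>0 f h n)

  -- The middle entry (2j + 1) (2j choose j) of the Leibniz triangle divides Ψ(2j + 1).
  Ψ-lower : ∀ j → 4 ^ j ≤ Ψ (suc (j + j))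
  Ψ-lower j = ≤-trans (central-lower j)
    (∣⇒≤ {{>-nonZero (∏>0 _ (primePower>0 N) N)}} (leibniz (Ψ N) j j (∣Ψ N)))
    where N = suc (j + j)

  -- Primes up to √N contribute at most N each, the other primes contribute themselves.
  Ψ-upper : ∀ N n r → 1 ≤ N → r ≤ n → n ≤ N → N < suc r * suc r →
            (∀ p → n < p → p ≤ N → ¬ Prime p) → Ψ N ≤ N ^ r * primorial n
  Ψ-upper N n r 1≤N r≤n n≤N N<r² none = subst (λ z → ∏ (primePower N) z ≤ N ^ r * primorial n) (m+[n∸m]≡n n≤N) (above (N ∸ n) (≤-reflexive (m+[n∸m]≡n n≤N)))
    where
    open ≤-Reasoning
    below : ∀ b → ∏ (primePower N) b ≤ N ^ b
    below zero = ≤-refl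
    below (suc b) = *-mono-≤ (primePower≤N N 1≤N (suc b)) (below b)
    middle : ∀ i → ∏ (primePower N) (r + i) ≤ N ^ r * primorial (r + i)
    middle zero rewrite +-identityʳ r = ≤-trans (below r) (m≤m*n (N ^ r) (primorial r) {{>-nonZero (primorial>0 r)}})
    middle (suc i) rewrite +-suc r i = begin
      primePower N (suc (r + i)) * ∏ (primePower N) (r + i) ≤⟨ *-mono-≤ (primePower≤primeOr1 N (suc (r + i)) (<-≤-trans N<r² (*-mono-≤ (s≤s (m≤m+n r i)) (s≤s (m≤m+n r i))))) (middle i) ⟩
      primeOr1 (suc (r + i)) * (N ^ r * primorial (r + i)) ≡⟨ lem (primeOr1 (suc (r + i))) (N ^ r) (primorial (r + i)) ⟩
      N ^ r * (primeOr1 (suc (r + i)) * primorial (r + i)) ∎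
      where lem : ∀ a b c → a * (b * c) ≡ b * (a * c)
            lem = solve-∀
    above : ∀ i → n + i ≤ N → ∏ (primePower N) (n + i) ≤ N ^ r * primorial n
    above zero _ = subst (λ z → ∏ (primePower N) z ≤ N ^ r * primorial n) (sym (+-identityʳ n))
      (subst (λ z → ∏ (primePower N) z ≤ N ^ r * primorial z) (m+[n∸m]≡n r≤n) (middle (n ∸ r)))
    above (suc i) le rewrite +-suc n i =
      ≤-trans (≤-reflexive (trans (cong (_* ∏ (primePower N) (n + i)) (primePower-nonPrime N _ (none _ (s≤s (m≤m+n n i)) le))) (*-identityˡ _)))
              (above i (<⇒≤ le))

  -- With h = 8 + i, the left side grows by less than the factor 4 when h grows by 1, and h = 8 is
  -- the first value at which it is below 4 ^ h.
  dyadic : ∀ i → 12 * ((9 + i) * 2 ^ (9 + i)) + 24 ≤ 4 ^ (8 + i)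
  dyadic zero = toWitness {a? = 12 * (9 * 2 ^ 9) + 24 ≤? 4 ^ 8} _
  dyadic (suc i) = begin
    12 * ((10 + i) * 2 ^ (10 + i)) + 24      ≡⟨ cong (λ z → 12 * z + 24) (lem₀ i (2 ^ (9 + i))) ⟩
    12 * ((20 + 2 * i) * 2 ^ (9 + i)) + 24   ≤⟨ by≤ (72 + (16 + 2 * i) * 12 * 2 ^ (9 + i)) (4 ⊛ dyadic i) (lem i (2 ^ (9 + i)) (4 ^ (8 + i))) ⟩
    4 * 4 ^ (8 + i) ∎
    where
    open ≤-Reasoning
    lem₀ : ∀ i a → (10 + i) * (2 * a) ≡ (20 + 2 * i) * a
    lem₀ = solve-∀
    lem : ∀ i a b → 12 * ((20 + 2 * i) * a) + 24 + 4 * b + (72 + (16 + 2 * i) * 12 * a) ≡ 4 * b + 4 * (12 * ((9 + i) * a) + 24)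
    lem = solve-∀

  firstPrime : ∀ n k → (∃ λ p → n < p × p ≤ n + k × Prime p) ⊎ (∀ p → n < p → p ≤ n + k → ¬ Prime p)
  firstPrime n zero = inj₂ λ p n<p p≤n _ → <⇒≱ n<p (subst (p ≤_) (+-identityʳ n) p≤n)
  firstPrime n (suc k) with firstPrime n k
  ... | inj₁ (p , n<p , p≤ , pp) = inj₁ (p , n<p , ≤-trans p≤ (+-monoʳ-≤ n (n≤1+n k)) , pp)
  ... | inj₂ none with prime? (n + suc k)
  ...   | yes pp = inj₁ (n + suc k , m<m+n n (s≤s z≤n) , ≤-refl , pp)
  ...   | no ¬pp = inj₂ λ p n<p p≤ pp → case m≤n⇒m<n∨m≡n p≤ of λ where
            (inj₁ lt) → none p n<p (s≤s⁻¹ (subst (p <_) (+-suc n k) lt)) pp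
            (inj₂ refl) → ¬pp pp

  -- With j = n + f, f ≈ n / 5 and N = 2j + 1, the bounds 4 ^ j ≤ Ψ N ≤ N ^ √N * 4 ^ n are incompatible.
  largeGap : ∀ n → 27400 ≤ n → ∃ λ p → Prime p × n < p × 5 * p ≤ 12 * n
  largeGap n big = case firstPrime n k of λ where
      (inj₁ (p , n<p , p≤ , pp)) → p , pp , n<p , ≤-trans (*-monoʳ-≤ 5 p≤) 5N≤
      (inj₂ none) → ⊥-elim (absurd none)
    where
    open ≤-Reasoning
    open import Data.Nat.DivMod using (m/n*n≤m; m≡m%n+[m/n]*n; _/_; _%_)
    -- One less than the quotient, so that N = 2n + 2f + 1 stays within 12n/5 in spite of the final
    -- 1.
    f = pred (n / 5)
    n%5≤4 : n % 5 ≤ 4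
    n%5≤4 = s≤s⁻¹ (m%n<n n 5)
    f-suc : suc f ≡ n / 5
    f-suc = suc-pred (n / 5) {{>-nonZero (case n / 5 ≤? 0 of λ where
      (yes z) → contradiction (≤-trans big (≤-trans (≤-reflexive (m≡m%n+[m/n]*n n 5)) (+-mono-≤ n%5≤4 (*-monoˡ-≤ 5 z)))) (toWitnessFalse {a? = 27400 ≤? 4} _)
      (no nz) → ≰⇒> nz)}}
      where open import Relation.Nullary.Decidable using (toWitnessFalse)
    n≤ : n ≤ 5 * f + 9
    n≤ = begin
      n ≡⟨ m≡m%n+[m/n]*n n 5 ⟩
      n % 5 + n / 5 * 5 ≤⟨ +-monoˡ-≤ _ n%5≤4 ⟩
      4 + n / 5 * 5 ≡⟨ cong (λ z → 4 + z * 5) f-suc ⟨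
      4 + suc f * 5 ≡⟨ lem f ⟩
      5 * f + 9 ∎
      where lem : ∀ f → 4 + suc f * 5 ≡ 5 * f + 9
            lem = solve-∀
    ≤n : 5 * f + 5 ≤ n
    ≤n = begin
      5 * f + 5 ≡⟨ lem f ⟩
      suc f * 5 ≡⟨ cong (_* 5) f-suc ⟩
      n / 5 * 5 ≤⟨ m/n*n≤m n 5 ⟩
      n ∎
      where lem : ∀ f → 5 * f + 5 ≡ suc f * 5
            lem = solve-∀
    j = n + f
    N = suc (j + j)
    k = suc (n + (f + f))
    N≡ : n + k ≡ N
    N≡ = lem n f
      where lem : ∀ n f → n + suc (n + (f + f)) ≡ suc (n + f + (n + f))
            lem = solve-∀
    5N≤ : 5 * (n + k) ≤ 12 * n
    5N≤ = by≤ 5 (2 ⊛ ≤n) (lem n f)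
      where lem : ∀ n f → 5 * (n + suc (n + (f + f))) + 2 * n + 5 ≡ 12 * n + 2 * (5 * f + 5)
            lem = solve-∀
    absurd : (∀ p → n < p → p ≤ n + k → ¬ Prime p) → ⊥
    absurd none with floorSqrt N | floorLog 4 (s≤s (s≤s z≤n)) N (s≤s z≤n)
    ... | r , rr≤N , N<rr | h , 4^h≤N , N<4^h = <⇒≱ N^r<4^f (*-cancelʳ-≤ (4 ^ f) (N ^ r) (4 ^ n) {{m^n≢0 4 n}} (begin
        4 ^ f * 4 ^ n     ≡⟨ ^-distribˡ-+-* 4 f n ⟨
        4 ^ (f + n)       ≡⟨ cong (4 ^_) (+-comm f n) ⟩
        4 ^ j             ≤⟨ Ψ-lower j ⟩
        Ψ N               ≤⟨ Ψ-upper N n r (s≤s z≤n) r≤n (≤-trans (m≤m+n n k) (≤-reflexive N≡)) N<rr (λ p n<p p≤N → none p n<p (subst (p ≤_) (sym N≡) p≤N)) ⟩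
        N ^ r * primorial n ≤⟨ *-monoʳ-≤ (N ^ r) (primorial-upper n) ⟩
        N ^ r * 4 ^ n ∎))
      where
      r≤n : r ≤ n
      r≤n = ≮⇒≥ λ n<r → <⇒≱ (begin-strict
            3 * n         <⟨ by≤ 2 (=≤ {n} refl) (lem n) ⟩
            suc n * 3     ≤⟨ *-monoʳ-≤ (suc n) (≤-trans (toWitness {a? = 3 ≤? 27401} _) (s≤s big)) ⟩
            suc n * suc n ≤⟨ *-mono-≤ n<r n<r ⟩
            r * r         ∎) (≤-trans rr≤N N≤3n)
        where
        N≤3n : N ≤ 3 * n
        N≤3n = *-cancelˡ-≤ 5 (≤-trans (subst (λ z → 5 * z ≤ 12 * n) N≡ 5N≤) (by≤ (3 * n) (=≤ {n} refl) (lem′ n)))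
          where lem′ : ∀ n → 12 * n + n + 3 * n ≡ 5 * (3 * n) + n
                lem′ = solve-∀
        lem : ∀ n → suc (3 * n) + n + 2 ≡ suc n * 3 + n
        lem = solve-∀
      -- The constant 27400 gives 5N ≥ 12n - 13 ≥ 5 · 4 ^ 8, the point from which `dyadic` applies.
      8≤h : 8 ≤ h
      8≤h = ≮⇒≥ λ h<8 → <⇒≱ (<-≤-trans N<4^h (^-monoʳ-≤ 4 h<8)) (*-cancelˡ-≤ 5 (begin
            5 * 4 ^ 8      ≤⟨ toWitness {a? = 5 * 4 ^ 8 ≤? 12 * 27400 ∸ 13} _ ⟩
            12 * 27400 ∸ 13 ≤⟨ ∸-monoˡ-≤ 13 (*-monoʳ-≤ 12 big) ⟩
            12 * n ∸ 13    ≤⟨ m≤n+o⇒m∸n≤o (12 * n) 13 (by≤ 0 (2 ⊛ n≤) (lem n f)) ⟩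
            5 * N          ∎))
        where lem : ∀ n f → 12 * n + 2 * (5 * f + 9) + 0 ≡ 13 + 5 * suc (n + f + (n + f)) + 2 * n
              lem = solve-∀
      f-lower : suc h * 2 ^ suc h ≤ f
      f-lower = *-cancelˡ-≤ 12 (+-cancelʳ-≤ 24 _ _ (begin
        12 * (suc h * 2 ^ suc h) + 24 ≤⟨ subst (λ z → 12 * (suc z * 2 ^ suc z) + 24 ≤ 4 ^ z) (m+[n∸m]≡n 8≤h) (dyadic (h ∸ 8)) ⟩
        4 ^ h       ≤⟨ 4^h≤N ⟩
        N           ≤⟨ by≤ 5 (2 ⊛ n≤) (lem n f) ⟩
        12 * f + 24 ∎))
        where lem : ∀ n f → suc (n + f + (n + f)) + 2 * (5 * f + 9) + 5 ≡ 12 * f + 24 + 2 * n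
              lem = solve-∀
      4^≡ : ∀ a → 4 ^ a ≡ 2 ^ a * 2 ^ a
      4^≡ a = trans (^-*-assoc 2 2 a) (trans (cong (λ z → 2 ^ (a + z)) (+-identityʳ a)) (^-distribˡ-+-* 2 a a))
      r< : r < 2 ^ suc h
      r< = ≰⇒> λ le → <⇒≱ N<4^h (begin
        4 ^ suc h             ≡⟨ 4^≡ (suc h) ⟩
        2 ^ suc h * 2 ^ suc h ≤⟨ *-mono-≤ le le ⟩
        r * r                 ≤⟨ rr≤N ⟩
        N ∎)
      -- As N < 4 ^ (h + 1) and r < 2 ^ (h + 1), the exponent of 4 is below (h + 1) 2 ^ (h + 1),
      -- which is at most f.
      N^r<4^f : N ^ r < 4 ^ f
      N^r<4^f = begin-strict
        N ^ r           ≤⟨ ^-monoˡ-≤ r (<⇒≤ N<4^h) ⟩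
        (4 ^ suc h) ^ r ≡⟨ ^-*-assoc 4 (suc h) r ⟩
        4 ^ (suc h * r) <⟨ ^-monoʳ-< 4 (s≤s (s≤s z≤n)) (<-≤-trans (*-monoʳ-< (suc h) r<) f-lower) ⟩
        4 ^ f ∎

  -- One link of a chain of primes: q serves every n with p ≤ n < q, because 5q ≤ 12p ≤ 12n. The two
  -- `True` arguments are settled by evaluation.
  nextPrime : ∀ {n} q {p} {_ : True (prime? q)} {_ : True (5 * q ≤? 12 * p)} → p ≤ n →
              (q ≤ n → ∃ λ p → Prime p × n < p × 5 * p ≤ 12 * n) → ∃ λ p → Prime p × n < p × 5 * p ≤ 12 * n
  nextPrime {n} q {p} {pq} {5q≤} p≤n further with q ≤? n
  ... | yes q≤n = further q≤n
  ... | no q≰n = q , toWitness pq , ≰⇒> q≰n , ≤-trans (toWitness 5q≤) (*-monoʳ-≤ 12 p≤n)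

  primeGap : ∀ n → 19 ≤ n → ∃ λ p → Prime p × n < p × 5 * p ≤ 12 * n
  primeGap n 19≤n =
    nextPrime 43 19≤n λ h → nextPrime 103 h λ h → nextPrime 241 h λ h →
    nextPrime 577 h λ h → nextPrime 1381 h λ h → nextPrime 3313 h λ h →
    nextPrime 7951 h λ h → nextPrime 19081 h λ h → nextPrime 45779 h λ h →
    largeGap n (≤-trans (toWitness {a? = 27400 ≤? 45779} _) h)

-- Cardinality bounds by injections into finite sets

module Bounds where
  open import Data.Nat
  open import Data.Nat.Properties
  open import Data.Fin using (Fin; zero; suc; join; combine; inject≤)
  open import Data.Fin.Properties using (any?; splitAt-join; combine-injective; inject≤-injective; injective⇒≤) renaming (_≟_ to _≟F_)
  open import Data.List using (List; _∷_; length; lookup)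
  open import Data.List.Relation.Unary.All as All using (All)
  open import Data.List.Relation.Unary.AllPairs using (_∷_)
  open import Data.List.Relation.Unary.Unique.Propositional using (Unique)
  open import Data.List.Membership.Propositional.Properties using (∈-lookup)
  open import Data.Product using (∃; _×_; _,_; proj₁; proj₂)
  open import Data.Sum using (_⊎_; inj₁; inj₂)
  open import Data.Sum.Properties using (inj₁-injective; inj₂-injective)
  open import Relation.Nullary using (¬_; Dec; yes; no; contradiction)
  open import Relation.Binary.PropositionalEquality

  -- The code may depend on the proof of P a, but equal codes only force equal elements, so an
  -- element with several proofs counts once. This suits overlapping unions and existential
  -- predicates.
  record Bounded {A : Set} (n : ℕ) (P : A → Set) : Set where
    field
      code      : ∀ a → P a → Fin n
      injective : ∀ {a b} (pa : P a) (pb : P b) → code a pa ≡ code b pb → a ≡ b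

  open Bounded

  private variable
    A B : Set
    m n : ℕ
    P Q R : A → Set

  bounded-none : (∀ a → ¬ P a) → Bounded n P
  bounded-none ¬P .code a pa = contradiction pa (¬P a)
  bounded-none ¬P .injective {a} pa = contradiction pa (¬P a)

  bounded-one : (∀ {a b} → P a → P b → a ≡ b) → Bounded 1 P
  bounded-one unique .code _ _ = zero
  bounded-one unique .injective pa pb _ = unique pa pb

  bounded-≤ : m ≤ n → Bounded m P → Bounded n P
  bounded-≤ m≤n b .code a pa = inject≤ (b .code a pa) m≤n
  bounded-≤ m≤n b .injective pa pb eq = b .injective pa pb (inject≤-injective m≤n m≤n _ _ eq)

  -- A preimage is chosen for each element, and S recovers the element from it. This serves residues
  -- that lie on several curves and so have no canonical preimage.
  bounded-rel : (S : B → A → Set) → (∀ {b a a′} → S b a → S b a′ → a ≡ a′) →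
                (∀ a → P a → ∃ λ b → Q b × S b a) → Bounded n Q → Bounded n P
  bounded-rel S functional pre b .code a pa = b .code _ (proj₁ (proj₂ (pre a pa)))
  bounded-rel S functional pre b .injective pa pb eq = functional
    (proj₂ (proj₂ (pre _ pa)))
    (subst (λ z → S z _) (sym (b .injective (proj₁ (proj₂ (pre _ pa))) (proj₁ (proj₂ (pre _ pb))) eq)) (proj₂ (proj₂ (pre _ pb))))

  bounded-map : (f : A → B) → (∀ {a b} → P a → P b → f a ≡ f b → a ≡ b) → (∀ {a} → P a → Q (f a)) →
                Bounded n Q → Bounded n P
  bounded-map f inj pq b .code a pa = b .code (f a) (pq pa)
  bounded-map f inj pq b .injective pa pb eq = inj pa pb (b .injective (pq pa) (pq pb) eq)

  bounded-⊆ : (∀ {a} → P a → Q a) → Bounded n Q → Bounded n P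
  bounded-⊆ = bounded-map (λ a → a) (λ _ _ eq → eq)

  bounded-∪ : (∀ a → R a → P a ⊎ Q a) → Bounded m P → Bounded n Q → Bounded (m + n) R
  bounded-∪ {R = R} {P = P} {Q = Q} {m = m} {n = n} split b c = record
    { code = λ a ra → join m n (codeOf (split a ra))
    ; injective = λ ra rb eq → inj (split _ ra) (split _ rb)
        (trans (sym (splitAt-join m n _)) (trans (cong (splitAt m) eq) (splitAt-join m n _))) }
    where
    open import Data.Fin using (splitAt)
    codeOf : ∀ {a} → P a ⊎ Q a → Fin m ⊎ Fin n
    codeOf (inj₁ pa) = inj₁ (b .code _ pa)
    codeOf (inj₂ qa) = inj₂ (c .code _ qa)
    inj : ∀ {a a′} (x : P a ⊎ Q a) (y : P a′ ⊎ Q a′) → codeOf x ≡ codeOf y → a ≡ a′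
    inj (inj₁ pa) (inj₁ pb) eq = b .injective pa pb (inj₁-injective eq)
    inj (inj₁ _) (inj₂ _) ()
    inj (inj₂ _) (inj₁ _) ()
    inj (inj₂ qa) (inj₂ qb) eq = c .injective qa qb (inj₂-injective eq)

  bounded-fibre : (f : A → B) → (∀ {a} → P a → Q (f a)) → Bounded m Q →
                  (∀ b → Bounded n (λ a → P a × f a ≡ b)) → Bounded (m * n) P
  bounded-fibre {P = P} f pq b F = record
    { code = λ a pa → combine (b .code (f a) (pq pa)) (F (f a) .code a (pa , refl))
    ; injective = λ pa pb eq → let (e₁ , e₂) = combine-injective _ _ _ _ eq in
        fibre (b .injective (pq pa) (pq pb) e₁) (pa , refl) (pb , refl) e₂ }
    where
    fibre : ∀ {a a′ y y′} → y ≡ y′ → (pa : P a × f a ≡ y) (pb : P a′ × f a′ ≡ y′) →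
            F y .code a pa ≡ F y′ .code a′ pb → a ≡ a′
    fibre refl pa pb = F _ .injective pa pb

  -- The hypothesis has the form in which a quadratic equation supplies it: one root divided out,
  -- the others satisfy the same linear equation.
  bounded-two : ∀ {k} {P : Fin k → Set} → (∀ i → Dec (P i)) →
                (∀ {i j l} → P i → P j → P l → i ≢ j → i ≢ l → j ≡ l) → Bounded 2 P
  bounded-two {P = P} P? three with any? P?
  ... | no none = bounded-none λ i pi → none (i , pi)
  ... | yes (i , pi) = bounded-∪ {P = λ j → j ≡ i} {Q = λ j → P j × i ≢ j} split
          (bounded-one λ e e′ → trans e (sym e′))
          (bounded-one λ (pj , i≢j) (pl , i≢l) → three pi pj pl i≢j i≢l)
    where
    split : ∀ j → P j → j ≡ i ⊎ (P j × i ≢ j)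
    split j pj with i ≟F j
    ... | yes i≡j = inj₁ (sym i≡j)
    ... | no i≢j  = inj₂ (pj , i≢j)

  lookup-injective : ∀ {xs : List A} → Unique xs → ∀ {i j} → lookup xs i ≡ lookup xs j → i ≡ j
  lookup-injective (_ ∷ _) {zero} {zero} _ = refl
  lookup-injective {xs = x ∷ xs} (x∉ ∷ _) {zero} {suc j} eq = contradiction eq (All.lookup x∉ (∈-lookup j))
  lookup-injective {xs = x ∷ xs} (x∉ ∷ _) {suc i} {zero} eq = contradiction (sym eq) (All.lookup x∉ (∈-lookup i))
  lookup-injective (_ ∷ u) {suc i} {suc j} eq = cong suc (lookup-injective u eq)

  bounded-length : ∀ {xs : List A} → Unique xs → All P xs → Bounded n P → length xs ≤ n
  bounded-length {xs = xs} u all b = injective⇒≤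
    {f = λ i → b .code (lookup xs i) (All.lookup all (∈-lookup i))}
    λ eq → lookup-injective u (b .injective (All.lookup all (∈-lookup _)) (All.lookup all (∈-lookup _)) eq)

-- Squares modulo p and the choice of the nonresidue

module QuadraticResidues where
  open import Data.Nat as ℕ using (ℕ; zero; suc; z≤n; s≤s)
  import Data.Nat.Properties as ℕ
  import Data.Nat.Divisibility as ℕ∣
  open import Data.Nat.Primality using (Prime; euclidsLemma; prime⇒nonZero; prime⇒nonTrivial; prime⇒irreducible)
  open import Data.Nat.Coprimality using (Coprime; coprime-Bézout)
  open import Data.Nat.GCD using (module Bézout)
  open import Data.Integer using (ℤ; +_; _+_; _*_; _-_; -_; ∣_∣; 0ℤ; 1ℤ)
  import Data.Integer.Properties as ℤ
  open import Data.Integer.DivMod using (_%ℕ_; _/ℕ_; n%ℕd<d; a≡a%ℕn+[a/ℕn]*n)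
  open import Data.Integer.Divisibility.Signed using (_∣_; divides; ∣⇒∣ᵤ; ∣ᵤ⇒∣; ∣n⇒∣m*n; ∣m∣n⇒∣m+n; _∣?_; m∣∣m∣)
  open import Data.Integer.Tactic.RingSolver using (solve-∀)
  open import Data.Fin using (Fin; zero; suc; toℕ; fromℕ<; remQuot; combine)
  open import Data.Fin.Properties using (pigeonhole; toℕ<n; toℕ-fromℕ<; toℕ-injective; combine-remQuot; any?; all?; ¬∀⟶∃¬)
  open import Data.Product using (∃; ∃₂; _×_; _,_; proj₁; proj₂)
  open import Data.Sum using (_⊎_; inj₁; inj₂; [_,_]′)
  open import Data.Empty using (⊥-elim)
  open import Function using (_∘_; case_of_)
  open import Relation.Nullary.Decidable using (map′)
  open import Relation.Nullary using (¬_; Dec; yes; no; contradiction)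
  open import Relation.Binary.PropositionalEquality

  module Residues (p : ℕ) (pp : Prime p) where

    instance p≢0 = prime⇒nonZero pp

    P∣_ : ℤ → Set
    P∣ z = + p ∣ z

    -- Congruences modulo p are derived as integer combinations of known ones; what remains is a
    -- polynomial identity for the ring solver.
    comb₁ : ∀ c {a e} → P∣ a → e ≡ c * a → P∣ e
    comb₁ c d refl = ∣n⇒∣m*n c d

    comb₂ : ∀ c d {a b e} → P∣ a → P∣ b → e ≡ c * a + d * b → P∣ e
    comb₂ c d x y refl = ∣m∣n⇒∣m+n (∣n⇒∣m*n c x) (∣n⇒∣m*n d y)

    euclid : ∀ a b → P∣ (a * b) → P∣ a ⊎ P∣ b
    euclid a b d = [ inj₁ ∘ ∣ᵤ⇒∣ , inj₂ ∘ ∣ᵤ⇒∣ ]′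
      (euclidsLemma ∣ a ∣ ∣ b ∣ pp (subst (p ℕ∣.∣_) (ℤ.abs-* a b) (∣⇒∣ᵤ d)))

    cancel : ∀ a b → ¬ P∣ a → P∣ (a * b) → P∣ b
    cancel a b ¬a d = [ (λ x → contradiction x ¬a) , (λ y → y) ]′ (euclid a b d)

    sq-zero : ∀ a → P∣ (a * a) → P∣ a
    sq-zero a d = [ (λ x → x) , (λ y → y) ]′ (euclid a a d)

    difference-of-squares : ∀ a b → P∣ (a * a - b * b) → P∣ (a - b) ⊎ P∣ (a + b)
    difference-of-squares a b d = euclid (a - b) (a + b) (comb₁ 1ℤ d (lem a b))
      where lem : ∀ a b → (a - b) * (a + b) ≡ 1ℤ * (a * a - b * b)
            lem = solve-∀

    ∤-small : ∀ n → 0 ℕ.< n → n ℕ.< p → ¬ P∣ (+ n)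
    ∤-small n 0<n n<p d = ℕ.<⇒≱ n<p (ℕ∣.∣⇒≤ {{ℕ.>-nonZero 0<n}} (∣⇒∣ᵤ d))

    ∤-* : ∀ a b → ¬ P∣ a → ¬ P∣ b → ¬ P∣ (a * b)
    ∤-* a b ¬a ¬b d = [ ¬a , ¬b ]′ (euclid a b d)

    congruent⇒≡ : ∀ i j → i ℕ.< p → j ℕ.< p → P∣ (+ i - + j) → i ≡ j
    congruent⇒≡ i j i<p j<p d with ∣ + i - + j ∣ in eq | ∣⇒∣ᵤ d
    ... | zero  | _  = ℤ.+-injective (ℤ.i-j≡0⇒i≡j (+ i) (+ j) (ℤ.∣i∣≡0⇒i≡0 eq))
    ... | suc k | d′ = contradiction (ℕ∣.∣⇒≤ d′)
          (ℕ.<⇒≱ (subst (ℕ._< p) (trans (sym (cong ∣_∣ (ℤ.m-n≡m⊖n i j))) eq) (ℕ.≤-<-trans (ℤ.∣m⊝n∣≤m⊔n i j) (ℕ.⊔-lub i<p j<p))))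

    abstract
      residue : ℤ → Fin p
      residue z = fromℕ< (n%ℕd<d z p)

      residue-≡ : ∀ z → P∣ (z - + toℕ (residue z))
      residue-≡ z = divides (z /ℕ p) (begin
        z - + toℕ (residue z)  ≡⟨ cong₂ (λ a b → a - + b) (a≡a%ℕn+[a/ℕn]*n z p) (toℕ-fromℕ< (n%ℕd<d z p)) ⟩
        + (z %ℕ p) + z /ℕ p * + p - + (z %ℕ p) ≡⟨ lem (+ (z %ℕ p)) (z /ℕ p * + p) ⟩
        z /ℕ p * + p ∎)
        where
        open ≡-Reasoning
        lem : ∀ a b → a + b - a ≡ b
        lem = solve-∀

    -- Bézout's identity over ℕ is applied to ∣ a ∣ = u * a, hence the factor u in the inverse; its
    -- two forms give the two signs.
    inverse : ∀ a → ¬ P∣ a → ∃ λ b → P∣ (a * b - 1ℤ)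
    inverse a ¬a with m∣∣m∣ {a} | coprime-Bézout {∣ a ∣} {p} coprime
      where
      coprime : Coprime ∣ a ∣ p
      coprime (d∣a , d∣p) with prime⇒irreducible pp d∣p
      ... | inj₁ d≡1  = d≡1
      ... | inj₂ refl = contradiction (∣ᵤ⇒∣ d∣a) ¬a
    ... | divides u ∣a∣≡ | Bézout.+- x y eq = + x * u , divides (+ y) (begin
        a * (+ x * u) - 1ℤ  ≡⟨ lem a (+ x) u ⟩
        + x * (u * a) - 1ℤ  ≡⟨ cong (λ z → + x * z - 1ℤ) ∣a∣≡ ⟨
        + x * + ∣ a ∣ - 1ℤ  ≡⟨ cong (_- 1ℤ) (ℤ.pos-* x ∣ a ∣) ⟨
        + (x ℕ.* ∣ a ∣) - 1ℤ ≡⟨ cong (λ z → + z - 1ℤ) eq ⟨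
        1ℤ + + (y ℕ.* p) - 1ℤ ≡⟨ cong (λ z → 1ℤ + z - 1ℤ) (ℤ.pos-* y p) ⟩
        1ℤ + + y * + p - 1ℤ ≡⟨ lem′ (+ y * + p) ⟩
        + y * + p ∎)
      where
      open ≡-Reasoning
      lem : ∀ a x u → a * (x * u) - 1ℤ ≡ x * (u * a) - 1ℤ
      lem = solve-∀
      lem′ : ∀ y → 1ℤ + y - 1ℤ ≡ y
      lem′ = solve-∀
    ... | divides u ∣a∣≡ | Bézout.-+ x y eq = - (+ x * u) , divides (- + y) (begin
        a * - (+ x * u) - 1ℤ  ≡⟨ lem a (+ x) u ⟩
        - (1ℤ + + x * (u * a))  ≡⟨ cong (λ z → - (1ℤ + + x * z)) ∣a∣≡ ⟨
        - (1ℤ + + x * + ∣ a ∣)  ≡⟨ cong (λ z → - (1ℤ + z)) (ℤ.pos-* x ∣ a ∣) ⟨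
        - + (1 ℕ.+ x ℕ.* ∣ a ∣) ≡⟨ cong (λ z → - + z) eq ⟩
        - + (y ℕ.* p)          ≡⟨ cong -_ (ℤ.pos-* y p) ⟩
        - (+ y * + p)          ≡⟨ lem′ (+ y) (+ p) ⟩
        - + y * + p ∎)
      where
      open ≡-Reasoning
      lem : ∀ a x u → a * - (x * u) - 1ℤ ≡ - (1ℤ + x * (u * a))
      lem = solve-∀
      lem′ : ∀ y p → - (y * p) ≡ - y * p
      lem′ = solve-∀

    Square : ℤ → Set
    Square z = ∃ λ w → P∣ (w * w - z)

    -- The root is c i / j, since c i² = d j² turns (c i / j)² into c d.
    ratio-square : ∀ c d i j → ¬ P∣ j → P∣ (c * (i * i) - d * (j * j)) → Square (c * d)
    ratio-square c d i j ¬j h with inverse j ¬j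
    ... | k , jk = c * i * k , comb₂ (c * (k * k)) (c * d * (j * k + 1ℤ)) h jk (lem c d i j k)
      where lem : ∀ c d i j k → c * i * k * (c * i * k) - c * d ≡ c * (k * k) * (c * (i * i) - d * (j * j)) + c * d * (j * k + 1ℤ) * (j * k - 1ℤ)
            lem = solve-∀

    ∣⇒Square : ∀ {z} → P∣ z → Square z
    ∣⇒Square {z} d = 0ℤ , comb₁ (- 1ℤ) d (lem z)
      where lem : ∀ z → 0ℤ * 0ℤ - z ≡ - 1ℤ * z
            lem = solve-∀

    module Odd (h : ℕ) (p≡ : p ≡ 1 ℕ.+ (h ℕ.+ h)) (2≤h : 2 ℕ.≤ h) where

      -- The nonzero residues up to sign, so that their squares are pairwise distinct.
      root : Fin h → ℤ
      root i = + suc (toℕ i)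

      root-∤ : ∀ i → ¬ P∣ root i
      root-∤ i = ∤-small _ (s≤s z≤n) (subst (suc (toℕ i) ℕ.<_) (sym p≡) (s≤s (ℕ.≤-trans (toℕ<n i) (ℕ.m≤m+n h h))))

      root-injective : ∀ i j → P∣ (root i * root i - root j * root j) → i ≡ j
      root-injective i j d = [ equal , ⊥-elim ∘ opposite ]′ (difference-of-squares (root i) (root j) d)
        where
        bound : ∀ i → suc (toℕ i) ℕ.< p
        bound i = subst (suc (toℕ i) ℕ.<_) (sym p≡) (s≤s (ℕ.≤-trans (toℕ<n i) (ℕ.m≤m+n h h)))
        equal : P∣ (root i - root j) → i ≡ j
        equal e = toℕ-injective (ℕ.suc-injective (congruent⇒≡ (suc (toℕ i)) (suc (toℕ j)) (bound i) (bound j) e))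
        opposite : ¬ P∣ (root i + root j)
        opposite = ∤-small (suc (toℕ i) ℕ.+ suc (toℕ j)) (s≤s z≤n)
          (subst (suc (toℕ i) ℕ.+ suc (toℕ j) ℕ.<_) (sym p≡) (s≤s (ℕ.+-mono-≤ (toℕ<n i) (toℕ<n j))))

      -- Up to sign every w is one of 0, ..., h, so there are at most h + 1 < p squares. Testing
      -- only these roots makes the property decidable, and a residue without a root can be
      -- extracted.
      nonSquare : ∃ λ g → ¬ Square g
      nonSquare = case all? SmallSquare? of λ where
          (yes all) → ⊥-elim (collision all)
          (no ¬all) → case ¬∀⟶∃¬ p SmallSquare SmallSquare? ¬all of λ where
            (r , ¬sq) → + toℕ r , λ sq → ¬sq (small r sq)
        where
        SmallSquare : Fin p → Set
        SmallSquare r = ∃ λ (w : Fin (suc h)) → P∣ (+ toℕ w * + toℕ w - + toℕ r)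
        SmallSquare? : ∀ r → Dec (SmallSquare r)
        SmallSquare? r = any? λ w → + p ∣? (+ toℕ w * + toℕ w - + toℕ r)
        collision : ¬ (∀ r → SmallSquare r)
        collision all with pigeonhole (subst (suc h ℕ.<_) (sym p≡) (s≤s (ℕ.m<m+n h (ℕ.≤-trans (s≤s z≤n) 2≤h)))) (proj₁ ∘ all)
        ... | i , j , i<j , eq = ℕ.<⇒≢ i<j (congruent⇒≡ _ _ (toℕ<n i) (toℕ<n j)
                (comb₂ 1ℤ (- 1ℤ) (proj₂ (all j)) (subst (λ w → P∣ (+ toℕ w * + toℕ w - + toℕ i)) eq (proj₂ (all i)))
                  (lem (+ toℕ (proj₁ (all j))) (+ toℕ i) (+ toℕ j))))
          where lem : ∀ w i j → i - j ≡ 1ℤ * (w * w - j) + - 1ℤ * (w * w - i)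
                lem = solve-∀
        small : ∀ r → Square (+ toℕ r) → SmallSquare r
        small r (w , d) with toℕ (residue w) ℕ.≤? h
        ... | yes t≤h = fromℕ< (s≤s t≤h) , subst (λ z → P∣ (+ z * + z - + toℕ r)) (sym (toℕ-fromℕ< (s≤s t≤h)))
                (comb₂ 1ℤ (- (w + + t)) d (residue-≡ w) (lem w (+ t) (+ toℕ r)))
          where
          t = toℕ (residue w)
          lem : ∀ w t r → t * t - r ≡ 1ℤ * (w * w - r) + - (w + t) * (w - t)
          lem = solve-∀
        ... | no t≰h = fromℕ< (s≤s u≤h) , subst (λ z → P∣ (+ z * + z - + toℕ r)) (sym (toℕ-fromℕ< (s≤s u≤h)))
                (comb₂ 1ℤ (w - + u) d w≡-u (lem w (+ u) (+ toℕ r)))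
          where
          t = toℕ (residue w)
          u = p ℕ.∸ t
          t+u : t ℕ.+ u ≡ p
          t+u = ℕ.m+[n∸m]≡n (ℕ.<⇒≤ (toℕ<n (residue w)))
          u≤h : u ℕ.≤ h
          u≤h = ℕ.+-cancelˡ-≤ (suc h) u h (ℕ.≤-trans (ℕ.+-monoˡ-≤ u (ℕ.≰⇒> t≰h)) (ℕ.≤-reflexive (trans t+u p≡)))
          w≡-u : P∣ (- (w + + u))
          w≡-u = comb₂ (- 1ℤ) (- 1ℤ) (residue-≡ w) (divides 1ℤ (sym (ℤ.*-identityˡ (+ p))))
            (trans (lem′ w (+ t) (+ u)) (cong (λ z → - 1ℤ * (w - + t) + - 1ℤ * + z) t+u))
            where lem′ : ∀ w t u → - (w + u) ≡ - 1ℤ * (w - t) + - 1ℤ * (t + u)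
                  lem′ = solve-∀
          lem : ∀ w u r → u * u - r ≡ 1ℤ * (w * w - r) + (w - u) * - (w + u)
          lem = solve-∀

      -- Among the 3h > p residues i², g i², D i² with 1 ≤ i ≤ h two coincide.
      square-or-twist : ∀ g → ¬ Square g → ∀ D → Square D ⊎ Square (g * D)
      square-or-twist g ¬sq-g D with + p ∣? D
      ... | yes d = inj₁ (∣⇒Square d)
      ... | no ¬D = collide (pigeonhole 3h>p (λ x → residue (value (remQuot h x))))
        where
        coeff : Fin 3 → ℤ
        coeff zero = 1ℤ
        coeff (suc zero) = g
        coeff (suc (suc zero)) = D
        value : Fin 3 × Fin h → ℤ
        value (a , i) = coeff a * (root i * root i)
        3h>p : p ℕ.< 3 ℕ.* h
        3h>p = subst (ℕ._< 3 ℕ.* h) (sym p≡) (subst (λ z → 2 ℕ.+ (h ℕ.+ h) ℕ.≤ z) (lem h) (ℕ.+-monoˡ-≤ (h ℕ.+ h) 2≤h))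
          where lem : ∀ h → h ℕ.+ (h ℕ.+ h) ≡ 3 ℕ.* h
                lem h = cong (λ z → h ℕ.+ (h ℕ.+ z)) (sym (ℕ.+-identityʳ h))
        ∤-coeff : ∀ a → ¬ P∣ coeff a
        ∤-coeff zero = ∤-small 1 (s≤s z≤n) (ℕ.nonTrivial⇒n>1 p {{prime⇒nonTrivial pp}})
        ∤-coeff (suc zero) = ¬sq-g ∘ ∣⇒Square
        ∤-coeff (suc (suc zero)) = ¬D
        one : ∀ z → Square (1ℤ * z) → Square z
        one z = subst Square (ℤ.*-identityˡ z)
        swap : ∀ y z → Square (y * z) → Square (z * y)
        swap y z = subst Square (ℤ.*-comm y z)
        decide : ∀ a b i j → (a ≡ b → i ≢ j) → P∣ (value (a , i) - value (b , j)) → Square D ⊎ Square (g * D)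
        decide a b i j apart d = go a b apart (ratio-square (coeff a) (coeff b) (root i) (root j) (root-∤ j) d) d
          where
          same : ∀ a → P∣ (value (a , i) - value (a , j)) → i ≡ j
          same a d = root-injective i j (cancel (coeff a) _ (∤-coeff a)
            (comb₁ 1ℤ d (lem (coeff a) (root i) (root j))))
            where lem : ∀ c i j → c * (i * i - j * j) ≡ 1ℤ * (c * (i * i) - c * (j * j))
                  lem = solve-∀
          -- A coincidence makes coeff a * coeff b a square. Equal coefficients would give i = j and
          -- the product g is excluded; the products D and g D are the two conclusions.
          go : ∀ a b → (a ≡ b → i ≢ j) → Square (coeff a * coeff b) → P∣ (value (a , i) - value (b , j)) → Square D ⊎ Square (g * D)
          go zero zero apart _ d = contradiction (same zero d) (apart refl)
          go zero (suc zero) _ sq _ = contradiction (one g sq) ¬sq-g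
          go zero (suc (suc zero)) _ sq _ = inj₁ (one D sq)
          go (suc zero) zero _ sq _ = contradiction (one g (swap g 1ℤ sq)) ¬sq-g
          go (suc zero) (suc zero) apart _ d = contradiction (same (suc zero) d) (apart refl)
          go (suc zero) (suc (suc zero)) _ sq _ = inj₂ sq
          go (suc (suc zero)) zero _ sq _ = inj₁ (one D (swap D 1ℤ sq))
          go (suc (suc zero)) (suc zero) _ sq _ = inj₂ (swap D g sq)
          go (suc (suc zero)) (suc (suc zero)) apart _ d = contradiction (same (suc (suc zero)) d) (apart refl)
        collide : (∃₂ λ x y → toℕ x ℕ.< toℕ y × residue (value (remQuot h x)) ≡ residue (value (remQuot h y))) → Square D ⊎ Square (g * D)
        collide (x , y , x<y , eq) = decide (proj₁ (remQuot h x)) (proj₁ (remQuot h y)) (proj₂ (remQuot {3} h x)) (proj₂ (remQuot {3} h y))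
          (λ a≡b i≡j → ℕ.<⇒≢ x<y (cong toℕ (trans (sym (combine-remQuot {3} h x)) (trans (cong₂ combine a≡b i≡j) (combine-remQuot {3} h y)))))
          (comb₂ 1ℤ (- 1ℤ) (residue-≡ (value (remQuot h x))) (residue-≡ (value (remQuot h y)))
            (trans (lem (value (remQuot h x)) (value (remQuot h y)) (+ toℕ (residue (value (remQuot h x)))))
              (cong (λ z → 1ℤ * (value (remQuot h x) - + toℕ (residue (value (remQuot h x)))) + - 1ℤ * (value (remQuot h y) - + toℕ z)) eq)))
          where lem : ∀ u v r → u - v ≡ 1ℤ * (u - r) + - 1ℤ * (v - r)
                lem = solve-∀

    module Good (19<p : 19 ℕ.< p) where

      ∤-literal : ∀ n → 0 ℕ.< n → n ℕ.≤ 19 → ¬ P∣ (+ n)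
      ∤-literal n 0<n n≤19 = ∤-small n 0<n (ℕ.≤-<-trans n≤19 19<p)

      -- If p divides g + 3 then 3 · 4g + 1 is -35 modulo p, the only constant of this kind that
      -- exceeds 19.
      ∤-35 : ¬ P∣ (+ 35)
      ∤-35 = ∤-* (+ 5) (+ 7) (∤-literal 5 (s≤s z≤n) (ℕ.≤ᵇ⇒≤ 5 19 _)) (∤-literal 7 (s≤s z≤n) (ℕ.≤ᵇ⇒≤ 7 19 _))

      -- Besides 2 and g, these are the factors of all the sums κ a + κ b, the leading coefficients
      -- of the quadratic equations for x.
      record Admissible (g : ℤ) : Set where
        field
          nonsquare : ¬ Square g
          ∤g+1      : ¬ P∣ (g + + 1)
          ∤g+3      : ¬ P∣ (g + + 3)
          ∤3g+1     : ¬ P∣ (+ 3 * g + + 1)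

      4*-nonSquare : ∀ g → ¬ Square g → ¬ Square (+ 4 * g)
      4*-nonSquare g ¬sq (w , d) = ¬sq (subst Square (ℤ.*-identityˡ g)
        (ratio-square 1ℤ g w (+ 2) (∤-literal 2 (s≤s z≤n) (ℕ.≤ᵇ⇒≤ 2 19 _)) (comb₁ 1ℤ d (lem w g))))
        where lem : ∀ w g → 1ℤ * (w * w) - g * (+ 2 * + 2) ≡ 1ℤ * (w * w - + 4 * g)
              lem = solve-∀

      -- If g is one of -1, -3, -1/3 modulo p then 4g is none of them.
      admissible : ∀ g → ¬ Square g → ∃ Admissible
      admissible g ¬sq with + p ∣? (g + + 1) | + p ∣? (g + + 3) | + p ∣? (+ 3 * g + + 1)
      ... | no a | no b | no c = g , record { nonsquare = ¬sq ; ∤g+1 = a ; ∤g+3 = b ; ∤3g+1 = c }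
      ... | yes a | _ | _ = + 4 * g , record
        { nonsquare = 4*-nonSquare g ¬sq
        ; ∤g+1 = λ d → ∤-literal 3 (s≤s z≤n) (ℕ.≤ᵇ⇒≤ 3 19 _) (comb₂ (+ 4) (- + 1) a d (l₁ g))
        ; ∤g+3 = λ d → ∤-literal 1 (s≤s z≤n) (ℕ.≤ᵇ⇒≤ 1 19 _) (comb₂ (+ 4) (- + 1) a d (l₂ g))
        ; ∤3g+1 = λ d → ∤-literal 11 (s≤s z≤n) (ℕ.≤ᵇ⇒≤ 11 19 _) (comb₂ (+ 12) (- + 1) a d (l₃ g)) }
        where
        l₁ : ∀ g → + 3 ≡ + 4 * (g + + 1) + - + 1 * (+ 4 * g + + 1)
        l₁ = solve-∀
        l₂ : ∀ g → + 1 ≡ + 4 * (g + + 1) + - + 1 * (+ 4 * g + + 3)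
        l₂ = solve-∀
        l₃ : ∀ g → + 11 ≡ + 12 * (g + + 1) + - + 1 * (+ 3 * (+ 4 * g) + + 1)
        l₃ = solve-∀
      ... | no _ | yes b | _ = + 4 * g , record
        { nonsquare = 4*-nonSquare g ¬sq
        ; ∤g+1 = λ d → ∤-literal 11 (s≤s z≤n) (ℕ.≤ᵇ⇒≤ 11 19 _) (comb₂ (+ 4) (- + 1) b d (l₁ g))
        ; ∤g+3 = λ d → ∤-literal 9 (s≤s z≤n) (ℕ.≤ᵇ⇒≤ 9 19 _) (comb₂ (+ 4) (- + 1) b d (l₂ g))
        ; ∤3g+1 = λ d → ∤-35 (comb₂ (+ 12) (- + 1) b d (l₃ g)) }
        where
        l₁ : ∀ g → + 11 ≡ + 4 * (g + + 3) + - + 1 * (+ 4 * g + + 1)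
        l₁ = solve-∀
        l₂ : ∀ g → + 9 ≡ + 4 * (g + + 3) + - + 1 * (+ 4 * g + + 3)
        l₂ = solve-∀
        l₃ : ∀ g → + 35 ≡ + 12 * (g + + 3) + - + 1 * (+ 3 * (+ 4 * g) + + 1)
        l₃ = solve-∀
      ... | no _ | no _ | yes c = + 4 * g , record
        { nonsquare = 4*-nonSquare g ¬sq
        ; ∤g+1 = λ d → ∤-literal 1 (s≤s z≤n) (ℕ.≤ᵇ⇒≤ 1 19 _) (comb₂ (+ 4) (- + 3) c d (l₁ g))
        ; ∤g+3 = λ d → ∤-literal 5 (s≤s z≤n) (ℕ.≤ᵇ⇒≤ 5 19 _) (comb₂ (- + 4) (+ 3) c d (l₂ g))
        ; ∤3g+1 = λ d → ∤-literal 3 (s≤s z≤n) (ℕ.≤ᵇ⇒≤ 3 19 _) (comb₂ (+ 4) (- + 1) c d (l₃ g)) }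
        where
        l₁ : ∀ g → + 1 ≡ + 4 * (+ 3 * g + + 1) + - + 3 * (+ 4 * g + + 1)
        l₁ = solve-∀
        l₂ : ∀ g → + 5 ≡ - + 4 * (+ 3 * g + + 1) + + 3 * (+ 4 * g + + 3)
        l₂ = solve-∀
        l₃ : ∀ g → + 3 ≡ + 4 * (+ 3 * g + + 1) + - + 1 * (+ 3 * (+ 4 * g) + + 1)
        l₃ = solve-∀

    -- The quadratic equations for sums of two points on the curves

    record Solves (κ λ′ s t x : ℤ) : Set where
      constructor solution
      field divisible : P∣ (κ * (x * x) + λ′ * ((s - x) * (s - x)) - t)
    open Solves

    Solves? : ∀ κ λ′ s t x → Dec (Solves κ λ′ s t x)
    Solves? κ λ′ s t x = map′ solution divisible (+ p ∣? _)

    -- Subtracting two instances and dividing by x - y leaves (κ + λ′) (x + y) = 2 λ′ s; the same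
    -- holds with z for y.
    two-solutions : ∀ κ λ′ s t → ¬ P∣ (κ + λ′) → ∀ x y z → Solves κ λ′ s t x → Solves κ λ′ s t y → Solves κ λ′ s t z →
                    ¬ P∣ (x - y) → ¬ P∣ (x - z) → P∣ (y - z)
    two-solutions κ λ′ s t ¬κλ x y z ex ey ez x≢y x≢z = cancel (κ + λ′) (y - z) ¬κλ
      (comb₂ 1ℤ (- 1ℤ) (slope y ey x≢y) (slope z ez x≢z) (lem κ λ′ s x y z))
      where
      slope : ∀ y → Solves κ λ′ s t y → ¬ P∣ (x - y) → P∣ ((κ + λ′) * (x + y) - + 2 * λ′ * s)
      slope y ey x≢y = cancel (x - y) _ x≢y (comb₂ 1ℤ (- 1ℤ) (ex .divisible) (ey .divisible) (lem κ λ′ s t x y))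
        where lem : ∀ κ λ′ s t x y → (x - y) * ((κ + λ′) * (x + y) - + 2 * λ′ * s) ≡
                    1ℤ * (κ * (x * x) + λ′ * ((s - x) * (s - x)) - t) + - 1ℤ * (κ * (y * y) + λ′ * ((s - y) * (s - y)) - t)
              lem = solve-∀
      lem : ∀ κ λ′ s x y z → (κ + λ′) * (y - z) ≡ 1ℤ * ((κ + λ′) * (x + y) - + 2 * λ′ * s) + - 1ℤ * ((κ + λ′) * (x + z) - + 2 * λ′ * s)
      lem = solve-∀

    Solves-cong : ∀ κ λ′ s t {x y} → P∣ (x - y) → Solves κ λ′ s t x → Solves κ λ′ s t y
    Solves-cong κ λ′ s t {x} {y} d ex = solution (comb₂ 1ℤ (- (κ * (x + y)) + λ′ * (+ 2 * s - x - y)) (ex .divisible) d (lem κ λ′ s t x y))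
      where lem : ∀ κ λ′ s t x y → κ * (y * y) + λ′ * ((s - y) * (s - y)) - t ≡
                  1ℤ * (κ * (x * x) + λ′ * ((s - x) * (s - x)) - t) + (- (κ * (x + y)) + λ′ * (+ 2 * s - x - y)) * (x - y)
            lem = solve-∀

    module Curves (19<p : 19 ℕ.< p) (h : ℕ) (p≡ : p ≡ 1 ℕ.+ (h ℕ.+ h)) (2≤h : 2 ℕ.≤ h)
                  (g : ℤ) (adm : Good.Admissible 19<p g) where
      open Odd h p≡ 2≤h
      open Good 19<p
      open Admissible adm

      -- κ₀κ₂/(κ₀+κ₂) = κ₁κ₁/(κ₁+κ₁), so the discriminants for (κ₀,κ₂) and (κ₁,κ₁)
      -- differ by the factor g up to squares.
      κ : Fin 3 → ℤ
      κ zero = g * (g + + 1)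
      κ (suc zero) = + 2 * g
      κ (suc (suc zero)) = g + + 1

      ∤2 : ¬ P∣ (+ 2)
      ∤2 = ∤-literal 2 (s≤s z≤n) (ℕ.≤ᵇ⇒≤ 2 19 _)

      ∤g : ¬ P∣ g
      ∤g = nonsquare ∘ ∣⇒Square

      ∤-κ+κ : ∀ a b → ¬ P∣ (κ a + κ b)
      ∤-κ+κ zero zero d = ∤-* (+ 2) _ ∤2 (∤-* g _ ∤g ∤g+1) (comb₁ 1ℤ d (lem g))
        where lem : ∀ g → + 2 * (g * (g + + 1)) ≡ 1ℤ * (g * (g + + 1) + g * (g + + 1))
              lem = solve-∀
      ∤-κ+κ zero (suc zero) d = ∤-* g _ ∤g ∤g+3 (comb₁ 1ℤ d (lem g))
        where lem : ∀ g → g * (g + + 3) ≡ 1ℤ * (g * (g + + 1) + + 2 * g)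
              lem = solve-∀
      ∤-κ+κ zero (suc (suc zero)) d = ∤-* _ _ ∤g+1 ∤g+1 (comb₁ 1ℤ d (lem g))
        where lem : ∀ g → (g + + 1) * (g + + 1) ≡ 1ℤ * (g * (g + + 1) + (g + + 1))
              lem = solve-∀
      ∤-κ+κ (suc zero) (suc zero) d = ∤-* (+ 2) _ ∤2 (∤-* (+ 2) g ∤2 ∤g) (comb₁ 1ℤ d (lem g))
        where lem : ∀ g → + 2 * (+ 2 * g) ≡ 1ℤ * (+ 2 * g + + 2 * g)
              lem = solve-∀
      ∤-κ+κ (suc zero) (suc (suc zero)) d = ∤3g+1 (comb₁ 1ℤ d (lem g))
        where lem : ∀ g → + 3 * g + + 1 ≡ 1ℤ * (+ 2 * g + (g + + 1))
              lem = solve-∀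
      ∤-κ+κ (suc (suc zero)) (suc (suc zero)) d = ∤-* (+ 2) _ ∤2 ∤g+1 (comb₁ 1ℤ d (lem g))
        where lem : ∀ g → + 2 * (g + + 1) ≡ 1ℤ * (g + + 1 + (g + + 1))
              lem = solve-∀
      ∤-κ+κ (suc zero) zero d = ∤-κ+κ zero (suc zero) (subst P∣_ (ℤ.+-comm (κ (suc zero)) (κ zero)) d)
      ∤-κ+κ (suc (suc zero)) zero d = ∤-κ+κ zero (suc (suc zero)) (subst P∣_ (ℤ.+-comm (κ (suc (suc zero))) (κ zero)) d)
      ∤-κ+κ (suc (suc zero)) (suc zero) d = ∤-κ+κ (suc zero) (suc (suc zero)) (subst P∣_ (ℤ.+-comm (κ (suc (suc zero))) (κ (suc zero))) d)

      pattern 0F = zero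
      pattern 1F = suc zero
      pattern 2F = suc (suc zero)

      -- Completing the square: the equation for (κ₀ , κ₂) is ((g + 1) x - s)² = D, and that for (κ₁
      -- , κ₁), multiplied by g, is (2 g x - g s)² = g D. A root w of the right side gives x.
      solvable : ∀ s t → ∃ (Solves (κ 1F) (κ 1F) s t) ⊎ ∃ (Solves (κ 0F) (κ 2F) s t)
      solvable s t with square-or-twist g nonsquare (t - g * (s * s))
      ... | inj₁ (w , d) with inverse (g + + 1) ∤g+1
      ...   | i , e = inj₂ (i * (w + s) , solution (comb₂ 1ℤ ((w + s) * (i * (w + s) * (g + + 1) - s + w)) d e (lem g s t w i)))
        where lem : ∀ g s t w i → g * (g + + 1) * (i * (w + s) * (i * (w + s))) + (g + + 1) * ((s - i * (w + s)) * (s - i * (w + s))) - t ≡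
                    1ℤ * (w * w - (t - g * (s * s))) + (w + s) * (i * (w + s) * (g + + 1) - s + w) * ((g + + 1) * i - 1ℤ)
              lem = solve-∀
      solvable s t | inj₂ (w , d) with inverse (+ 2 * g) (∤-* (+ 2) g ∤2 ∤g)
      ...   | i , e = inj₁ (x , solution (cancel g _ ∤g (comb₂ 1ℤ ((w + g * s) * (+ 2 * g * x - g * s + w)) d e (lem g s t w i))))
        where
        x = i * (w + g * s)
        lem : ∀ g s t w i → g * (+ 2 * g * (i * (w + g * s) * (i * (w + g * s))) + + 2 * g * ((s - i * (w + g * s)) * (s - i * (w + g * s))) - t) ≡
              1ℤ * (w * w - g * (t - g * (s * s))) + (w + g * s) * (+ 2 * g * (i * (w + g * s)) - g * s + w) * (+ 2 * g * i - 1ℤ)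
        lem = solve-∀

      -- The completed squares satisfy w₁² = g D and w₂² = D, so w₁² = g w₂²; as g is not a square,
      -- both vanish.
      unique-if-both : ∀ s t {x y} → Solves (κ 1F) (κ 1F) s t x → Solves (κ 0F) (κ 2F) s t y →
                       P∣ (+ 2 * g * x - g * s) × P∣ ((g + + 1) * y - s)
      unique-if-both s t {x} {y} ex ey = P∣w₁ , P∣w₂
        where
        w₁ = + 2 * g * x - g * s
        w₂ = (g + + 1) * y - s
        d : P∣ (1ℤ * (w₁ * w₁) - g * (w₂ * w₂))
        d = comb₂ g (- g) (ex .divisible) (ey .divisible) (lem g s t x y)
          where lem : ∀ g s t x y → 1ℤ * ((+ 2 * g * x - g * s) * (+ 2 * g * x - g * s)) - g * (((g + + 1) * y - s) * ((g + + 1) * y - s)) ≡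
                      g * (+ 2 * g * (x * x) + + 2 * g * ((s - x) * (s - x)) - t) + - g * (g * (g + + 1) * (y * y) + (g + + 1) * ((s - y) * (s - y)) - t)
                lem = solve-∀
        P∣w₂ : P∣ w₂
        P∣w₂ with + p ∣? w₂
        ... | yes e = e
        ... | no ¬e = contradiction (subst Square (ℤ.*-identityˡ g) (ratio-square 1ℤ g w₁ w₂ ¬e d)) nonsquare
        P∣w₁ : P∣ w₁
        P∣w₁ = sq-zero w₁ (comb₂ 1ℤ (g * w₂) d P∣w₂ (lem g w₁ w₂))
          where lem : ∀ g a b → a * a ≡ 1ℤ * (1ℤ * (a * a) - g * (b * b)) + g * b * b
                lem = solve-∀

      unique₁₁ : ∀ s t {x x′ y} → Solves (κ 0F) (κ 2F) s t y → Solves (κ 1F) (κ 1F) s t x → Solves (κ 1F) (κ 1F) s t x′ → P∣ (x - x′)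
      unique₁₁ s t {x} {x′} ey ex ex′ = cancel (+ 2 * g) _ (∤-* (+ 2) g ∤2 ∤g)
        (comb₂ 1ℤ (- 1ℤ) (proj₁ (unique-if-both s t ex ey)) (proj₁ (unique-if-both s t ex′ ey)) (lem g s x x′))
        where lem : ∀ g s x y → + 2 * g * (x - y) ≡ 1ℤ * (+ 2 * g * x - g * s) + - 1ℤ * (+ 2 * g * y - g * s)
              lem = solve-∀

      unique₀₂ : ∀ s t {x y y′} → Solves (κ 1F) (κ 1F) s t x → Solves (κ 0F) (κ 2F) s t y → Solves (κ 0F) (κ 2F) s t y′ → P∣ (y - y′)
      unique₀₂ s t {x} {y} {y′} ex ey ey′ = cancel (g + + 1) _ ∤g+1
        (comb₂ 1ℤ (- 1ℤ) (proj₂ (unique-if-both s t ex ey)) (proj₂ (unique-if-both s t ex ey′)) (lem g s y y′))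
        where lem : ∀ g s x y → (g + + 1) * (x - y) ≡ 1ℤ * ((g + + 1) * x - s) + - 1ℤ * ((g + + 1) * y - s)
              lem = solve-∀

      Solves-reflect : ∀ κ λ′ s t x → Solves κ λ′ s t x → Solves λ′ κ s t (s - x)
      Solves-reflect κ λ′ s t x d = solution (comb₁ 1ℤ (d .divisible) (lem κ λ′ s t x))
        where lem : ∀ κ λ′ s t x → λ′ * ((s - x) * (s - x)) + κ * ((s - (s - x)) * (s - (s - x))) - t ≡
                    1ℤ * (κ * (x * x) + λ′ * ((s - x) * (s - x)) - t)
              lem = solve-∀

-- Counting pairs of lifted points with given digit sums

module SlotCounting where
  open Bounds
  open QuadraticResidues
  open LinearArithmetic
  open import Data.Nat as ℕ using (ℕ; z≤n; s≤s; _≤_; _<_)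
  import Data.Nat.Properties as ℕ
  import Data.Nat.DivMod as ℕ
  open import Data.Nat.Primality using (Prime)
  open import Data.Integer using (ℤ; +_; _+_; _*_; _-_; -_; 1ℤ)
  import Data.Integer.Properties as ℤ
  open import Data.Integer.Tactic.RingSolver using (solve-∀)
  open import Data.Fin using (Fin; toℕ; fromℕ<)
  open import Data.Fin.Properties using (any?; toℕ-injective; toℕ<n; toℕ-fromℕ<)
  open import Data.Product using (∃; _×_; _,_; proj₁; proj₂)
  open import Data.Sum using (_⊎_; inj₁; inj₂)
  open import Function using (_∘_)
  open import Relation.Nullary.Decidable using (map′)
  open import Data.Integer.Divisibility.Signed using (_∣?_)
  open import Relation.Nullary using (¬_; Dec; yes; no)
  open import Relation.Binary.PropositionalEquality

  module Counting (p : ℕ) (pp : Prime p) (19<p : 19 < p) (h : ℕ) (p≡ : p ≡ 1 ℕ.+ (h ℕ.+ h)) (2≤h : 2 ≤ h)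
                  (g : ℤ) (adm : Residues.Good.Admissible p pp 19<p g) where
    open Residues p pp
    open Curves 19<p h p≡ 2≤h g adm

    Triple : Set
    Triple = Fin 3 × Fin 3 × Fin p

    SolvesTriple : ℤ → ℤ → Triple → Set
    SolvesTriple s t (a , b , r) = Solves (κ a) (κ b) s t (+ toℕ r)

    OfType : ℤ → ℤ → Fin 3 → Fin 3 → Triple → Set
    OfType s t a b (a′ , b′ , r) = a′ ≡ a × b′ ≡ b × Solves (κ a) (κ b) s t (+ toℕ r)

    ofType : ∀ {n} s t a b → Bounded n (λ (r : Fin p) → Solves (κ a) (κ b) s t (+ toℕ r)) → Bounded n (OfType s t a b)
    ofType s t a b = bounded-map (proj₂ ∘ proj₂) (λ { (refl , refl , _) (refl , refl , _) refl → refl }) (proj₂ ∘ proj₂)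

    residue-unique : ∀ {r r′ : Fin p} → P∣ (+ toℕ r - + toℕ r′) → r ≡ r′
    residue-unique {r} {r′} d = toℕ-injective (congruent⇒≡ (toℕ r) (toℕ r′) (toℕ<n r) (toℕ<n r′) d)

    ≤2 : ∀ s t a b → Bounded 2 (OfType s t a b)
    ≤2 s t a b = ofType s t a b (bounded-two (λ r → Solves? (κ a) (κ b) s t (+ toℕ r))
      λ ex ey ez x≢y x≢z → residue-unique (two-solutions (κ a) (κ b) s t (∤-κ+κ a b) _ _ _ ex ey ez
        (x≢y ∘ residue-unique) (x≢z ∘ residue-unique)))

    none : ∀ {n} s t a b → ¬ (∃ λ (r : Fin p) → Solves (κ a) (κ b) s t (+ toℕ r)) → Bounded n (OfType s t a b)
    none s t a b ¬∃ = bounded-none λ { (_ , _ , r) (_ , _ , e) → ¬∃ (r , e) }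

    Harmonic : ℤ → ℤ → Triple → Set
    Harmonic s t q = OfType s t 1F 1F q ⊎ OfType s t 0F 2F q ⊎ OfType s t 2F 0F q

    harmonic-∪ : ∀ {i j k} s t → Bounded i (OfType s t 1F 1F) → Bounded j (OfType s t 0F 2F) → Bounded k (OfType s t 2F 0F) →
                 Bounded (i ℕ.+ (j ℕ.+ k)) (Harmonic s t)
    harmonic-∪ s t b c d = bounded-∪ (λ _ q → q) b (bounded-∪ (λ _ q → q) c d)

    reflect : ∀ s t a b {r : Fin p} → Solves (κ a) (κ b) s t (+ toℕ r) → ∃ λ (r′ : Fin p) → Solves (κ b) (κ a) s t (+ toℕ r′)
    reflect s t a b {r} e = residue (s - + toℕ r) ,
      Solves-cong (κ b) (κ a) s t (residue-≡ (s - + toℕ r)) (Solves-reflect (κ a) (κ b) s t (+ toℕ r) e)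

    harmonic : ∀ s t → Bounded 4 (Harmonic s t)
    harmonic s t with any? (λ r → Solves? (κ 1F) (κ 1F) s t (+ toℕ r)) | any? (λ r → Solves? (κ 0F) (κ 2F) s t (+ toℕ r))
    ... | no ¬₁₁ | _ = harmonic-∪ s t (none {0} s t 1F 1F ¬₁₁) (≤2 s t 0F 2F) (≤2 s t 2F 0F)
    ... | yes _ | no ¬₀₂ = harmonic-∪ s t (≤2 s t 1F 1F) (none {0} s t 0F 2F ¬₀₂)
            -- An empty class satisfies any bound; 2 is chosen so that 2 + (0 + 2) is 4.
            (none {2} s t 2F 0F λ (r , e) → ¬₀₂ (reflect s t 2F 0F {r} e))
    ... | yes (x , ex) | yes (y , ey) = bounded-≤ (s≤s (s≤s (s≤s z≤n))) (harmonic-∪ s t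
            (ofType s t 1F 1F (bounded-one λ e e′ → residue-unique (unique₁₁ s t ey e e′)))
            (ofType s t 0F 2F (bounded-one λ e e′ → residue-unique (unique₀₂ s t ex e e′)))
            (ofType s t 2F 0F (bounded-one λ {r} {r′} e e′ → residue-unique
              (comb₁ (- 1ℤ) (unique₀₂ s t ex (Solves-reflect (κ 2F) (κ 0F) s t (+ toℕ r) e) (Solves-reflect (κ 2F) (κ 0F) s t (+ toℕ r′) e′))
                (lem s (+ toℕ r) (+ toℕ r′))))))
      where lem : ∀ s a b → a - b ≡ - 1ℤ * (s - a - (s - b))
            lem = solve-∀

    triples : ∀ s t → Bounded 16 (SolvesTriple s t)
    triples s t = bounded-∪ split (harmonic s t) (bounded-∪ (λ _ q → q) (≤2 s t 0F 0F) (bounded-∪ (λ _ q → q) (≤2 s t 0F 1F)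
      (bounded-∪ (λ _ q → q) (≤2 s t 1F 0F) (bounded-∪ (λ _ q → q) (≤2 s t 1F 2F) (bounded-∪ (λ _ q → q) (≤2 s t 2F 1F) (≤2 s t 2F 2F))))))
      where
      split : ∀ q → SolvesTriple s t q → Harmonic s t q ⊎ OfType s t 0F 0F q ⊎ OfType s t 0F 1F q ⊎ OfType s t 1F 0F q ⊎
                                         OfType s t 1F 2F q ⊎ OfType s t 2F 1F q ⊎ OfType s t 2F 2F q
      split (0F , 0F , r) e = inj₂ (inj₁ (refl , refl , e))
      split (0F , 1F , r) e = inj₂ (inj₂ (inj₁ (refl , refl , e)))
      split (0F , 2F , r) e = inj₁ (inj₂ (inj₁ (refl , refl , e)))
      split (1F , 0F , r) e = inj₂ (inj₂ (inj₂ (inj₁ (refl , refl , e))))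
      split (1F , 1F , r) e = inj₁ (inj₁ (refl , refl , e))
      split (1F , 2F , r) e = inj₂ (inj₂ (inj₂ (inj₂ (inj₁ (refl , refl , e)))))
      split (2F , 0F , r) e = inj₁ (inj₂ (inj₂ (refl , refl , e)))
      split (2F , 1F , r) e = inj₂ (inj₂ (inj₂ (inj₂ (inj₂ (inj₁ (refl , refl , e))))))
      split (2F , 2F , r) e = inj₂ (inj₂ (inj₂ (inj₂ (inj₂ (inj₂ (refl , refl , e))))))

    -- Congruent numbers have the same remainder after subtraction of lo, so the quotient by p, one
    -- of w values, identifies them.
    progression : ∀ (P : ℕ → Set) lo w → (∀ {x} → P x → lo ≤ x × x < lo ℕ.+ w ℕ.* p) →
                  (∀ {x y} → P x → P y → P∣ (+ x - + y)) → Bounded w P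
    progression P lo w range cong-p = record
      { code = λ x px → fromℕ< (ℕ.m<n*o⇒m/o<n {x ℕ.∸ lo} {w} {p} (ℕ.+-cancelˡ-< lo _ _
          (subst (_< lo ℕ.+ w ℕ.* p) (sym (ℕ.m+[n∸m]≡n (proj₁ (range px)))) (proj₂ (range px)))))
      ; injective = λ {x} {y} px py eq → same px py (trans (sym (toℕ-fromℕ< _)) (trans (cong toℕ eq) (toℕ-fromℕ< _))) }
      where
      decompose : ∀ x → lo ≤ x → x ≡ lo ℕ.+ ((x ℕ.∸ lo) ℕ.% p ℕ.+ (x ℕ.∸ lo) ℕ./ p ℕ.* p)
      decompose x lo≤x = trans (sym (ℕ.m+[n∸m]≡n lo≤x)) (cong (lo ℕ.+_) (ℕ.m≡m%n+[m/n]*n (x ℕ.∸ lo) p))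
      shift : ∀ a q r → + (a ℕ.+ (r ℕ.+ q)) ≡ + a + (+ r + + q)
      shift a q r = trans (ℤ.pos-+ a (r ℕ.+ q)) (cong (λ z → + a + z) (ℤ.pos-+ r q))
      same : ∀ {x y} → P x → P y → (x ℕ.∸ lo) ℕ./ p ≡ (y ℕ.∸ lo) ℕ./ p → x ≡ y
      same {x} {y} px py eq = trans x≡ (trans (cong₂ (λ r q → lo ℕ.+ (r ℕ.+ q ℕ.* p)) r≡ eq) (sym y≡))
        where
        x≡ = decompose x (proj₁ (range px))
        y≡ = decompose y (proj₁ (range py))
        r₁ = (x ℕ.∸ lo) ℕ.% p
        r₂ = (y ℕ.∸ lo) ℕ.% p
        q₁ = (x ℕ.∸ lo) ℕ./ p ℕ.* p
        q₂ = (y ℕ.∸ lo) ℕ./ p ℕ.* p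
        diff : + r₁ - + r₂ ≡ 1ℤ * (+ x - + y)
        diff = begin
          + r₁ - + r₂  ≡⟨ lem (+ lo) (+ q₁) (+ r₁) (+ r₂) ⟩
          1ℤ * (+ lo + (+ r₁ + + q₁) - (+ lo + (+ r₂ + + q₁))) ≡⟨ cong (λ z → 1ℤ * (+ lo + (+ r₁ + + q₁) - (+ lo + (+ r₂ + + (z ℕ.* p))))) eq ⟩
          1ℤ * (+ lo + (+ r₁ + + q₁) - (+ lo + (+ r₂ + + q₂))) ≡⟨ cong₂ (λ u v → 1ℤ * (u - v)) (trans (cong +_ x≡) (shift lo q₁ r₁)) (trans (cong +_ y≡) (shift lo q₂ r₂)) ⟨
          1ℤ * (+ x - + y) ∎
          where
          open ≡-Reasoning
          lem : ∀ l q a b → a - b ≡ 1ℤ * (l + (a + q) - (l + (b + q)))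
          lem = solve-∀
        r≡ : r₁ ≡ r₂
        r≡ = congruent⇒≡ r₁ r₂ (ℕ.m%n<n _ p) (ℕ.m%n<n _ p) (comb₁ 1ℤ (cong-p px py) diff)

    Point : Set
    Point = Fin 3 × ℕ × ℕ

    record OnCurve (k : Fin 3) (x y : ℕ) : Set where
      constructor onCurve
      field congruence : P∣ (+ y - κ k * (+ x * + x))
    open OnCurve

    onCurve? : ∀ k x y → Dec (OnCurve k x y)
    onCurve? k x y = map′ onCurve congruence (+ p ∣? _)

    -- Only the first point is confined to a window, of W periods in x and w in y; the digit sums
    -- then determine the coordinates of the second.
    record Slot (s t lox W loy w : ℕ) (u : Point × Point) : Set where
      constructor slot
      k  = proj₁ (proj₁ u)
      x  = proj₁ (proj₂ (proj₁ u))
      y  = proj₂ (proj₂ (proj₁ u))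
      k′ = proj₁ (proj₂ u)
      x′ = proj₁ (proj₂ (proj₂ u))
      y′ = proj₂ (proj₂ (proj₂ u))
      field
        on     : OnCurve k x y
        on′    : OnCurve k′ x′ y′
        x+x′   : x ℕ.+ x′ ≡ s
        y+y′   : y ℕ.+ y′ ≡ t
        rangex : lox ≤ x × x < lox ℕ.+ W ℕ.* p
        rangey : loy ≤ y × y < loy ℕ.+ w ℕ.* p

    -- There are 16 choices of (k , k′ , x modulo p), then W lifts of x, then w lifts of y, whose
    -- residue is that of κ k x².
    slot-bound : ∀ s t lox W loy w → Bounded (16 ℕ.* (W ℕ.* w)) (Slot s t lox W loy w)
    slot-bound s t lox W loy w = bounded-fibre triple solves (triples (+ s) (+ t)) λ q →
      bounded-fibre abscissa (λ {u} u∈ → u , u∈ , refl) (abscissas q) λ x₀ →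
      bounded-map ordinate (determined q x₀) (λ {u} u∈ → u , u∈ , refl) (ordinates q x₀)
      where
      triple : Point × Point → Triple
      triple ((k , x , _) , (k′ , _ , _)) = k , k′ , residue (+ x)
      abscissa ordinate : Point × Point → ℕ
      abscissa ((_ , x , _) , _) = x
      ordinate ((_ , _ , y) , _) = y
      solves : ∀ {u} → Slot s t lox W loy w u → SolvesTriple (+ s) (+ t) (triple u)
      solves {(k , x , y) , (k′ , x′ , y′)} (slot on on′ refl refl _ _) =
        Solves-cong (κ k) (κ k′) (+ s) (+ t) {+ x} {+ toℕ (residue (+ x))} (residue-≡ (+ x)) (solution (comb₂ (- 1ℤ) (- 1ℤ) (on .congruence) (on′ .congruence)
          (trans (cong₂ (λ s t → κ k * (+ x * + x) + κ k′ * ((s - + x) * (s - + x)) - t) (ℤ.pos-+ x x′) (ℤ.pos-+ y y′))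
                 (lem (κ k) (κ k′) (+ x) (+ x′) (+ y) (+ y′)))))
        where lem : ∀ a b x x′ y y′ → a * (x * x) + b * ((x + x′ - x) * (x + x′ - x)) - (y + y′) ≡
                    - 1ℤ * (y - a * (x * x)) + - 1ℤ * (y′ - b * (x′ * x′))
              lem = solve-∀
      InFibre : Triple → Point × Point → Set
      InFibre q u = Slot s t lox W loy w u × triple u ≡ q
      Abscissa : Triple → ℕ → Set
      Abscissa q x = ∃ λ u → InFibre q u × abscissa u ≡ x
      abscissas : ∀ q → Bounded W (Abscissa q)
      abscissas q = progression (Abscissa q) lox W (λ { (_ , (u∈ , _) , refl) → Slot.rangex u∈ })
        λ { (u , (_ , e) , refl) (v , (_ , e′) , refl) → same-residue (+ abscissa u) (+ abscissa v) (cong (proj₂ ∘ proj₂) (trans e (sym e′))) }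
        where
        same-residue : ∀ a b → residue a ≡ residue b → P∣ (a - b)
        same-residue a b eq = comb₂ 1ℤ (- 1ℤ) (residue-≡ a) (residue-≡ b)
          (trans (lem a b (+ toℕ (residue a))) (cong (λ r → 1ℤ * (a - + toℕ (residue a)) + - 1ℤ * (b - + toℕ r)) eq))
          where lem : ∀ a b r → a - b ≡ 1ℤ * (a - r) + - 1ℤ * (b - r)
                lem = solve-∀
      Ordinate : Triple → ℕ → ℕ → Set
      Ordinate q x₀ y = ∃ λ u → (InFibre q u × abscissa u ≡ x₀) × ordinate u ≡ y
      ordinates : ∀ q x₀ → Bounded w (Ordinate q x₀)
      ordinates q x₀ = progression (Ordinate q x₀) loy w (λ { (_ , ((u∈ , _) , _) , refl) → Slot.rangey u∈ })
        λ { (((k , _ , y) , _) , ((u∈ , refl) , refl) , refl) (((_ , _ , y′) , _) , ((v∈ , refl) , refl) , refl) →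
            comb₂ 1ℤ (- 1ℤ) (Slot.on u∈ .congruence) (Slot.on v∈ .congruence) (lem (κ k) (+ x₀) (+ y) (+ y′)) }
        where lem : ∀ a x y y′ → y - y′ ≡ 1ℤ * (y - a * (x * x)) + - 1ℤ * (y′ - a * (x * x))
              lem = solve-∀
      determined : ∀ q x₀ {u v} → InFibre q u × abscissa u ≡ x₀ → InFibre q v × abscissa v ≡ x₀ → ordinate u ≡ ordinate v → u ≡ v
      determined q x₀ {(k , x , y) , (k′ , x′ , y′)} {(l , _ , _) , (l′ , z′ , w′)} ((u∈ , eq) , refl) ((v∈ , eq′) , refl) refl
        with cong proj₁ (trans eq (sym eq′)) | cong (proj₁ ∘ proj₂) (trans eq (sym eq′))
           | ℕ.+-cancelˡ-≡ x x′ z′ (trans (Slot.x+x′ u∈) (sym (Slot.x+x′ v∈)))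
           | ℕ.+-cancelˡ-≡ y y′ w′ (trans (Slot.y+y′ u∈) (sym (Slot.y+y′ v∈)))
      ... | refl | refl | refl | refl = refl

-- Two-digit integers and their sums n and n + m

module DigitSums where
  open Bounds
  open QuadraticResidues
  open SlotCounting
  open LinearArithmetic
  open import Data.Nat as ℕ using (ℕ; suc; z≤n; s≤s; _≤_; _<_)
  import Data.Nat.Properties as ℕ
  import Data.Nat.DivMod as ℕ
  import Data.Nat.Tactic.RingSolver as ℕSolver
  open import Data.Nat.Primality using (Prime)
  open import Data.Integer using (ℤ; +_; _+_; _*_; _-_; -_; 1ℤ)
  import Data.Integer.Properties as ℤ
  open import Data.Integer.Tactic.RingSolver using (solve-∀)
  open import Data.Fin using (Fin; suc; toℕ)
  open import Data.Fin.Properties using (toℕ<n)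
  open import Data.Product using (∃; ∃₂; _×_; _,_; proj₁; proj₂)
  open import Data.Sum using (_⊎_; inj₁; inj₂; [_,_]′)
  open import Function using (case_of_)
  open import Relation.Nullary.Decidable using (map′; _×-dec_)
  open import Relation.Nullary using (¬_; Dec; yes; no)
  open import Relation.Binary.PropositionalEquality

  div-mod-unique : ∀ {N a b} L .{{_ : ℕ.NonZero L}} → L ℕ.* a ℕ.+ b ≡ N → b < L → a ≡ N ℕ./ L × b ≡ N ℕ.% L
  div-mod-unique {N} {a} {b} L refl b<L = a≡ , b≡
    where
    open ≡-Reasoning
    b≡ : b ≡ (L ℕ.* a ℕ.+ b) ℕ.% L
    b≡ = begin
      b                      ≡⟨ ℕ.m<n⇒m%n≡m b<L ⟨
      b ℕ.% L                ≡⟨ ℕ.[m+kn]%n≡m%n b a L ⟨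
      (b ℕ.+ a ℕ.* L) ℕ.% L  ≡⟨ cong (ℕ._% L) (lem L a b) ⟩
      (L ℕ.* a ℕ.+ b) ℕ.% L  ∎
      where lem : ∀ L a b → b ℕ.+ a ℕ.* L ≡ L ℕ.* a ℕ.+ b
            lem = ℕSolver.solve-∀
    a≡ : a ≡ (L ℕ.* a ℕ.+ b) ℕ./ L
    a≡ = ℕ.*-cancelʳ-≡ a _ L (ℕ.+-cancelˡ-≡ b _ _ (begin
      b ℕ.+ a ℕ.* L  ≡⟨ lem L a b ⟩
      L ℕ.* a ℕ.+ b  ≡⟨ ℕ.m≡m%n+[m/n]*n _ L ⟩
      (L ℕ.* a ℕ.+ b) ℕ.% L ℕ.+ (L ℕ.* a ℕ.+ b) ℕ./ L ℕ.* L ≡⟨ cong (ℕ._+ (L ℕ.* a ℕ.+ b) ℕ./ L ℕ.* L) b≡ ⟨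
      b ℕ.+ (L ℕ.* a ℕ.+ b) ℕ./ L ℕ.* L ∎))
      where lem : ∀ L a b → b ℕ.+ a ℕ.* L ≡ L ℕ.* a ℕ.+ b
            lem = ℕSolver.solve-∀

  -- The low digit y has range Y and base L, the high digit x has range X with m / L in the role of
  -- the base. The lower bound on 2X serves covering and the upper one counting; the gap between
  -- them leaves room for odd m / L.
  module Construct (p : ℕ) (pp : Prime p) (19<p : 19 < p) (h : ℕ) (p≡ : p ≡ 1 ℕ.+ (h ℕ.+ h)) (2≤h : 2 ≤ h)
                   (g : ℤ) (adm : Residues.Good.Admissible p pp 19<p g)
                   (L Y : ℕ) .{{_ : ℕ.NonZero L}} (2Y≡ : Y ℕ.+ Y ≡ L ℕ.+ 2 ℕ.* p) (Y≤3p : Y ≤ 3 ℕ.* p) (Y≤L : Y ≤ L)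
                   (m X : ℕ) (X≤4p : X ≤ 4 ℕ.* p) (X≤M : X ≤ m ℕ./ L)
                   (2X≤ : 2 ℕ.* X ≤ m ℕ./ L ℕ.+ 3 ℕ.* p) (≤2X : m ℕ./ L ℕ.+ 2 ℕ.* p ≤ 2 ℕ.* X) where
    open Residues p pp
    open Curves 19<p h p≡ 2≤h g adm
    open Counting p pp 19<p h p≡ 2≤h g adm

    M = m ℕ./ L

    record InBox (k : Fin 3) (x y : ℕ) : Set where
      constructor inBox
      field
        on : OnCurve k x y
        x< : x < X
        y< : y < Y
    open InBox

    inBox? : ∀ k x y → Dec (InBox k x y)
    inBox? k x y = map′ (λ (o , a , b) → inBox o a b) (λ b → b .on , b .x< , b .y<) (onCurve? k x y ×-dec (x ℕ.<? X) ×-dec (y ℕ.<? Y))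

    record Sum (N : ℕ) (u : Point × Point) : Set where
      constructor sum
      k  = proj₁ (proj₁ u)
      x  = proj₁ (proj₂ (proj₁ u))
      y  = proj₂ (proj₂ (proj₁ u))
      k′ = proj₁ (proj₂ u)
      x′ = proj₁ (proj₂ (proj₂ u))
      y′ = proj₂ (proj₂ (proj₂ u))
      field
        left  : InBox k x y
        right : InBox k′ x′ y′
        total : L ℕ.* (x ℕ.+ x′) ℕ.+ (y ℕ.+ y′) ≡ N

    abscissa-of : Point × Point → ℕ
    abscissa-of ((_ , x , _) , _) = x

    -- As Y = p + L/2, the y-ranges for y + y′ = t and for y + y′ = t + L have w₁ and w₂ lifts per residue class.
    y-split : ∀ t → ∃₂ λ w₁ w₂ → w₁ ℕ.+ w₂ ≡ 3 × (t < w₁ ℕ.* p ⊎ Y ≤ w₁ ℕ.* p) × 2 ℕ.* p ≤ suc t ℕ.+ w₂ ℕ.* p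
    y-split t with suc t ℕ.≤? 1 ℕ.* p | suc t ℕ.≤? 2 ℕ.* p
    ... | yes le | _ = 1 , 2 , refl , inj₁ le , ℕ.m≤n+m _ (suc t)
    ... | no gt | yes le = 2 , 1 , refl , inj₁ le , by≤ 1 (ℕ.≰⇒> gt) (lem t p)
      where lem : ∀ t p → 2 ℕ.* p ℕ.+ suc t ℕ.+ 1 ≡ suc t ℕ.+ 1 ℕ.* p ℕ.+ suc (1 ℕ.* p)
            lem = ℕSolver.solve-∀
    -- Here a carry would need y + y′ = t + L ≥ 2Y, which is impossible.
    ... | no _ | no gt = 3 , 0 , refl , inj₂ Y≤3p , ℕ.≤-trans (ℕ.<⇒≤ (ℕ.≰⇒> gt)) (ℕ.m≤m+n (suc t) 0)

    -- As y, y′ < Y ≤ L, at most one carry occurs: for N = L s₀ + t₀ the digit sums are (s₀ , t₀) or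
    -- (s₀ - 1 , t₀ + L). In the second case y′ < Y forces y > t₀ + L - Y, the start of its window.
    sum-bound : ∀ N lo W → (∀ {u} → Sum N u → lo ≤ abscissa-of u × abscissa-of u < lo ℕ.+ W ℕ.* p) →
                Bounded (16 ℕ.* (W ℕ.* 3)) (Sum N)
    sum-bound N lo W xs with y-split (N ℕ.% L)
    ... | w₁ , w₂ , w≡ , c₁ , c₂ = subst (λ w → Bounded w (Sum N)) eq
          (bounded-∪ split (slot-bound s₀ t₀ lo W 0 w₁) (slot-bound (s₀ ℕ.∸ 1) (t₀ ℕ.+ L) lo W (suc t₀ ℕ.+ L ℕ.∸ Y) w₂))
      where
      s₀ = N ℕ./ L
      t₀ = N ℕ.% L
      eq : 16 ℕ.* (W ℕ.* w₁) ℕ.+ 16 ℕ.* (W ℕ.* w₂) ≡ 16 ℕ.* (W ℕ.* 3)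
      eq = trans (lem W w₁ w₂) (cong (λ w → 16 ℕ.* (W ℕ.* w)) w≡)
        where lem : ∀ W a b → 16 ℕ.* (W ℕ.* a) ℕ.+ 16 ℕ.* (W ℕ.* b) ≡ 16 ℕ.* (W ℕ.* (a ℕ.+ b))
              lem = ℕSolver.solve-∀
      split : ∀ u → Sum N u → Slot s₀ t₀ lo W 0 w₁ u ⊎ Slot (s₀ ℕ.∸ 1) (t₀ ℕ.+ L) lo W (suc t₀ ℕ.+ L ℕ.∸ Y) w₂ u
      split ((k , x , y) , (k′ , x′ , y′)) S@(sum left right total) with y ℕ.+ y′ ℕ.<? L
      ... | yes lt = inj₁ (slot (left .on) (right .on) s≡ t≡ (xs S)
              (z≤n , [ (λ t₀< → ℕ.≤-<-trans (ℕ.≤-trans (ℕ.m≤m+n y y′) (ℕ.≤-reflexive t≡)) t₀<) , ℕ.<-≤-trans (left .y<) ]′ c₁))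
        where
        s≡ = proj₁ (div-mod-unique L total lt)
        t≡ = proj₂ (div-mod-unique L total lt)
      ... | no ¬lt = inj₂ (slot (left .on) (right .on) (cong ℕ.pred s≡) t≡ (xs S) (lower , upper))
        where
        r = y ℕ.+ y′ ℕ.∸ L
        r+L : r ℕ.+ L ≡ y ℕ.+ y′
        r+L = ℕ.m∸n+n≡m (ℕ.≮⇒≥ ¬lt)
        r<L : r < L
        r<L = ℕ.+-cancelʳ-< L r L (subst (_< L ℕ.+ L) (sym r+L) (ℕ.<-≤-trans (ℕ.+-mono-<-≤ (left .y<) (ℕ.<⇒≤ (right .y<))) (ℕ.+-mono-≤ Y≤L Y≤L)))
        unique = div-mod-unique {N} {suc (x ℕ.+ x′)} {r} L
          (trans (lem L (x ℕ.+ x′) r) (trans (cong (L ℕ.* (x ℕ.+ x′) ℕ.+_) r+L) total)) r<L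
          where lem : ∀ L a r → L ℕ.* suc a ℕ.+ r ≡ L ℕ.* a ℕ.+ (r ℕ.+ L)
                lem = ℕSolver.solve-∀
        s≡ : suc (x ℕ.+ x′) ≡ s₀
        s≡ = proj₁ unique
        t≡ : y ℕ.+ y′ ≡ t₀ ℕ.+ L
        t≡ = trans (sym r+L) (cong (ℕ._+ L) (proj₂ unique))
        lower : suc t₀ ℕ.+ L ℕ.∸ Y ≤ y
        lower = ℕ.m≤n+o⇒m∸n≤o (suc t₀ ℕ.+ L) Y (by≤ 0 (right .y< ⊕ =≤ (sym t≡)) (lem y y′ t₀ L Y))
          where lem : ∀ y y′ t L Y → suc t ℕ.+ L ℕ.+ (Y ℕ.+ (y ℕ.+ y′)) ℕ.+ 0 ≡ Y ℕ.+ y ℕ.+ (suc y′ ℕ.+ (t ℕ.+ L))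
                lem = ℕSolver.solve-∀
        upper : y < suc t₀ ℕ.+ L ℕ.∸ Y ℕ.+ w₂ ℕ.* p
        upper = ℕ.<-≤-trans (left .y<) (by≤ 0 (=≤ 2Y≡ ⊕ c₂ ⊕ ℕ.m≤n+m∸n (suc t₀ ℕ.+ L) Y) (lem t₀ L Y p (suc t₀ ℕ.+ L ℕ.∸ Y) w₂))
          where lem : ∀ t L Y p d w → Y ℕ.+ (L ℕ.+ 2 ℕ.* p ℕ.+ (suc t ℕ.+ w ℕ.* p ℕ.+ (Y ℕ.+ d))) ℕ.+ 0 ≡
                      d ℕ.+ w ℕ.* p ℕ.+ (Y ℕ.+ Y ℕ.+ (2 ℕ.* p ℕ.+ (suc t ℕ.+ L)))
                lem = ℕSolver.solve-∀

    -- A carry can make x + x′ one less than N / L; together with x′ < X this gives the bound.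
    x-lower : ∀ N {u} → Sum N u → N ℕ./ L ℕ.∸ X ≤ abscissa-of u
    x-lower N {(k , x , y) , (k′ , x′ , y′)} (sum left right total) = ℕ.m≤n+o⇒m∸n≤o (N ℕ./ L) X
      (ℕ.s≤s⁻¹ (ℕ.<-≤-trans N/L< (s≤s (by≤ 0 (right .x<) (lem x x′ X)))))
      where
      lem : ∀ x x′ X → suc (x ℕ.+ x′) ℕ.+ X ℕ.+ 0 ≡ X ℕ.+ x ℕ.+ suc x′
      lem = ℕSolver.solve-∀
      N/L< : N ℕ./ L < suc (suc (x ℕ.+ x′))
      N/L< = ℕ.m<n*o⇒m/o<n (subst₂ _<_ total (lem′ L (x ℕ.+ x′))
        (ℕ.+-monoʳ-< (L ℕ.* (x ℕ.+ x′)) (ℕ.+-mono-<-≤ (ℕ.<-≤-trans (left .y<) Y≤L) (ℕ.<⇒≤ (ℕ.<-≤-trans (right .y<) Y≤L)))))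
        where lem′ : ∀ L a → L ℕ.* a ℕ.+ (L ℕ.+ L) ≡ suc (suc a) ℕ.* L
              lem′ = ℕSolver.solve-∀

    x-upper : ∀ N {u} → Sum N u → abscissa-of u ≤ N ℕ./ L
    x-upper N {(k , x , y) , (k′ , x′ , y′)} (sum left right total) = subst (_≤ N ℕ./ L) (ℕ.m*n/n≡m x L)
      (ℕ./-monoˡ-≤ L (subst (x ℕ.* L ≤_) total (subst (_≤ L ℕ.* (x ℕ.+ x′) ℕ.+ (y ℕ.+ y′)) (ℕ.*-comm L x)
        (ℕ.≤-trans (ℕ.*-monoʳ-≤ L (ℕ.m≤m+n x x′)) (ℕ.m≤m+n _ (y ℕ.+ y′))))))

    [n+m]/L : ∀ n → n ℕ./ L ℕ.+ M ≤ (n ℕ.+ m) ℕ./ L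
    [n+m]/L n = subst (_≤ (n ℕ.+ m) ℕ./ L) (ℕ.m*n/n≡m (n ℕ./ L ℕ.+ M) L) (ℕ./-monoˡ-≤ L
      (subst (_≤ n ℕ.+ m) (sym (ℕ.*-distribʳ-+ L (n ℕ./ L) M)) (ℕ.m/n*n≤m n L ⊕ ℕ.m/n*n≤m m L)))

    -- With q = ⌊⌊n/L⌋/p⌋ ≤ 2, the sums n and n + m leave room for q + 1 and for 3 - q values of x
    -- per residue class.
    sums-bound : ∀ n → Bounded 192 (λ u → Sum n u ⊎ Sum (n ℕ.+ m) u)
    sums-bound n with 3 ℕ.≤? n ℕ./ L ℕ./ p
    -- From n / L ≥ 3p on, n + m would need x ≥ X and has no representation, while x < X ≤ 4p gives
    -- the sum n four lifts.
    ... | yes 3≤q = bounded-∪ {m = 192} {n = 0} (λ _ u∈ → u∈)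
            (sum-bound n 0 4 λ { {u} (sum left _ _) → z≤n , ℕ.<-≤-trans (left .x<) X≤4p })
            (bounded-none λ { u@((_ , x , _) , _) S@(sum left _ _) → ℕ.<⇒≱ (left .x<) (ℕ.≤-trans X≤lo (x-lower (n ℕ.+ m) S)) })
      where
      X≤lo : X ≤ (n ℕ.+ m) ℕ./ L ℕ.∸ X
      X≤lo = ℕ.m+n≤o⇒m≤o∸n X (by≤ 0 (2X≤ ⊕ [n+m]/L n ⊕ ℕ.*-monoˡ-≤ p 3≤q ⊕ ℕ.m/n*n≤m (n ℕ./ L) p)
        (lem X ((n ℕ.+ m) ℕ./ L) M p (n ℕ./ L) (n ℕ./ L ℕ./ p)))
        where lem : ∀ X S M p s q → X ℕ.+ X ℕ.+ (M ℕ.+ 3 ℕ.* p ℕ.+ (S ℕ.+ (q ℕ.* p ℕ.+ s))) ℕ.+ 0 ≡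
                    S ℕ.+ (2 ℕ.* X ℕ.+ (s ℕ.+ M ℕ.+ (3 ℕ.* p ℕ.+ q ℕ.* p)))
              lem = ℕSolver.solve-∀
    ... | no ¬3≤q = subst (λ w → Bounded w (λ u → Sum n u ⊎ Sum (n ℕ.+ m) u)) (weights q (ℕ.≤-pred (ℕ.≰⇒> ¬3≤q))) (bounded-∪ (λ _ u∈ → u∈)
            (sum-bound n 0 (suc q) λ {u} S → z≤n , ℕ.≤-<-trans (x-upper n S) s<)
            (sum-bound (n ℕ.+ m) lo (3 ℕ.∸ q) λ { {u} S@(sum left _ _) → x-lower (n ℕ.+ m) S , ℕ.<-≤-trans (left .x<) X≤ }))
      where
      q = n ℕ./ L ℕ./ p
      lo = (n ℕ.+ m) ℕ./ L ℕ.∸ X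
      weights : ∀ q → q ≤ 2 → 16 ℕ.* (suc q ℕ.* 3) ℕ.+ 16 ℕ.* ((3 ℕ.∸ q) ℕ.* 3) ≡ 192
      weights 0 _ = refl
      weights 1 _ = refl
      weights 2 _ = refl
      weights (suc (suc (suc _))) (s≤s (s≤s ()))
      s< : n ℕ./ L < suc q ℕ.* p
      s< = subst (_< suc q ℕ.* p) (sym (ℕ.m≡m%n+[m/n]*n (n ℕ./ L) p)) (ℕ.+-monoˡ-< (q ℕ.* p) (ℕ.m%n<n (n ℕ./ L) p))
      X≤ : X ≤ lo ℕ.+ (3 ℕ.∸ q) ℕ.* p
      X≤ = by≤ 0 (2X≤ ⊕ [n+m]/L n ⊕ ℕ.m/n*n≤m (n ℕ./ L) p ⊕ ℕ.m≤n+m∸n ((n ℕ.+ m) ℕ./ L) X ⊕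
             ℕ.*-monoˡ-≤ p (=≤ (sym (ℕ.m+[n∸m]≡n (ℕ.<⇒≤ (ℕ.≰⇒> ¬3≤q))))))
        (lem X ((n ℕ.+ m) ℕ./ L) M p (n ℕ./ L) q lo (3 ℕ.∸ q))
        where lem : ∀ X S M p s q l r → X ℕ.+ (M ℕ.+ 3 ℕ.* p ℕ.+ (S ℕ.+ (s ℕ.+ (X ℕ.+ l ℕ.+ (q ℕ.+ r) ℕ.* p)))) ℕ.+ 0 ≡
                    l ℕ.+ r ℕ.* p ℕ.+ (2 ℕ.* X ℕ.+ (s ℕ.+ M ℕ.+ (q ℕ.* p ℕ.+ (S ℕ.+ 3 ℕ.* p))))
              lem = ℕSolver.solve-∀

    -- Existence of representations

    congruent-in-interval : ∀ z lo → ∃ λ x → lo ≤ x × x < lo ℕ.+ p × P∣ (+ x - z)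
    congruent-in-interval z lo = lo ℕ.+ r , ℕ.m≤m+n lo r , ℕ.+-monoʳ-< lo (toℕ<n (residue (z - + lo))) ,
      comb₁ (- 1ℤ) (residue-≡ (z - + lo)) (trans (cong (_- z) (ℤ.pos-+ lo r)) (lem (+ lo) (+ r) z))
      where
      r = toℕ (residue (z - + lo))
      lem : ∀ l r z → l + r - z ≡ - 1ℤ * (z - l - r)
      lem = solve-∀

    -- The x with x ≤ s, x < B and s - x < B form an interval of length min(s + 1, 2B - s - 1), at
    -- least p, which meets every residue class.
    split-congruent : ∀ z s B → p ≤ suc s → suc s ℕ.+ p ≤ 2 ℕ.* B →
                      ∃₂ λ x x′ → x < B × x′ < B × x ℕ.+ x′ ≡ s × P∣ (+ x - z)
    split-congruent z s B p≤ ≤2B with congruent-in-interval z (suc s ℕ.∸ B)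
    ... | x , lo≤x , x<hi , d = x , s ℕ.∸ x , ℕ.<-≤-trans x<hi lo+p≤B , s-x<B , ℕ.m+[n∸m]≡n x≤s , d
      where
      lo = suc s ℕ.∸ B
      p≤B : p ≤ B
      p≤B = ℕ.*-cancelˡ-≤ 2 (ℕ.≤-trans (by≤ 0 p≤ (lem p s)) ≤2B)
        where lem : ∀ p s → 2 ℕ.* p ℕ.+ suc s ℕ.+ 0 ≡ suc s ℕ.+ p ℕ.+ p
              lem = ℕSolver.solve-∀
      lo+p≤B : lo ℕ.+ p ≤ B
      lo+p≤B with ℕ.≤-total (suc s) B
      ... | inj₁ le = subst (λ l → l ℕ.+ p ≤ B) (sym (ℕ.m≤n⇒m∸n≡0 le)) p≤B
      ... | inj₂ ge = ℕ.+-cancelˡ-≤ B _ _ (by≤ 0 (≤2B ⊕ =≤ (ℕ.m+[n∸m]≡n ge)) (lem B lo p s))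
        where lem : ∀ B l p s → B ℕ.+ (l ℕ.+ p) ℕ.+ (2 ℕ.* B ℕ.+ suc s) ℕ.+ 0 ≡ B ℕ.+ B ℕ.+ (suc s ℕ.+ p ℕ.+ (B ℕ.+ l))
              lem = ℕSolver.solve-∀
      lo+p≤s : lo ℕ.+ p ≤ suc s
      lo+p≤s with ℕ.≤-total (suc s) B
      ... | inj₁ le = subst (λ l → l ℕ.+ p ≤ suc s) (sym (ℕ.m≤n⇒m∸n≡0 le)) p≤
      ... | inj₂ ge = ℕ.≤-trans (ℕ.+-monoʳ-≤ lo p≤B) (ℕ.≤-reflexive (ℕ.m∸n+n≡m ge))
      x≤s : x ≤ s
      x≤s = ℕ.s≤s⁻¹ (ℕ.<-≤-trans x<hi lo+p≤s)
      s-x<B : s ℕ.∸ x < B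
      s-x<B = ℕ.+-cancelˡ-≤ x _ _ (by≤ 0 (ℕ.m≤n+m∸n (suc s) B ⊕ lo≤x ⊕ =≤ (ℕ.m+[n∸m]≡n x≤s)) (lem x (s ℕ.∸ x) B s lo))
        where lem : ∀ x d B s l → x ℕ.+ suc d ℕ.+ (B ℕ.+ l ℕ.+ (x ℕ.+ s)) ℕ.+ 0 ≡ x ℕ.+ B ℕ.+ (suc s ℕ.+ (l ℕ.+ (x ℕ.+ d)))
              lem = ℕSolver.solve-∀

    -- x is lifted from z and y from κ k x²; subtracting the first point from the solved equation
    -- puts the second on its curve.
    realise : ∀ k k′ s t z → Solves (κ k) (κ k′) (+ s) (+ t) z → p ≤ suc s → suc s ℕ.+ p ≤ 2 ℕ.* X →
              p ≤ suc t → suc t ℕ.+ p ≤ 2 ℕ.* Y → ∃ (Sum (L ℕ.* s ℕ.+ t))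
    realise k k′ s t z ez p≤s s≤ p≤t t≤ with split-congruent z s X p≤s s≤
    ... | x , x′ , x<X , x′<X , refl , dx with split-congruent (κ k * (+ x * + x)) t Y p≤t t≤
    ...   | y , y′ , y<Y , y′<Y , refl , dy = ((k , x , y) , (k′ , x′ , y′)) ,
            sum (inBox (onCurve dy) x<X y<Y)
                (inBox (onCurve (comb₂ (- 1ℤ) (- 1ℤ) (ex .Solves.divisible) dy
                  (trans (lem (κ k) (κ k′) (+ x) (+ x′) (+ y) (+ y′))
                    (cong₂ (λ s t → - 1ℤ * (κ k * (+ x * + x) + κ k′ * ((s - + x) * (s - + x)) - t) + - 1ℤ * (+ y - κ k * (+ x * + x)))
                      (sym (ℤ.pos-+ x x′)) (sym (ℤ.pos-+ y y′)))))) x′<X y′<Y) refl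
      where
      ex : Solves (κ k) (κ k′) (+ (x ℕ.+ x′)) (+ (y ℕ.+ y′)) (+ x)
      ex = Solves-cong (κ k) (κ k′) _ _ (comb₁ (- 1ℤ) dx (lem′ z (+ x))) ez
        where lem′ : ∀ z x → z - x ≡ - 1ℤ * (x - z)
              lem′ = solve-∀
      lem : ∀ a b x x′ y y′ → y′ - b * (x′ * x′) ≡
            - 1ℤ * (a * (x * x) + b * ((x + x′ - x) * (x + x′ - x)) - (y + y′)) + - 1ℤ * (y - a * (x * x))
      lem = solve-∀

    p-1 = h ℕ.+ h

    base = L ℕ.* p-1 ℕ.+ p-1

    -- The digits q ≤ m / L and ρ < L of N - base, raised by p - 1, are the digit sums; the lower
    -- bound on 2X and the value of 2Y keep them in reach.
    window : ∀ N → base ≤ N → N < base ℕ.+ m → ∃ (Sum N)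
    window N base≤N N< = subst (λ N → ∃ (Sum N)) N≡ (case solvable (+ s) (+ t) of λ where
        (inj₁ (z , ez)) → realise 1F 1F s t z ez p≤s s≤ p≤t t≤
        (inj₂ (z , ez)) → realise 0F 2F s t z ez p≤s s≤ p≤t t≤)
      where
      D = N ℕ.∸ base
      D<m : D < m
      D<m = ℕ.+-cancelˡ-< base D m (subst (_< base ℕ.+ m) (sym (ℕ.m+[n∸m]≡n base≤N)) N<)
      q = D ℕ./ L
      ρ = D ℕ.% L
      s = p-1 ℕ.+ q
      t = p-1 ℕ.+ ρ
      N≡ : L ℕ.* s ℕ.+ t ≡ N
      N≡ = trans (lem L p-1 q ρ) (trans (cong (base ℕ.+_) (sym (ℕ.m≡m%n+[m/n]*n D L))) (ℕ.m+[n∸m]≡n base≤N))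
        where lem : ∀ L r q ρ → L ℕ.* (r ℕ.+ q) ℕ.+ (r ℕ.+ ρ) ≡ L ℕ.* r ℕ.+ r ℕ.+ (ρ ℕ.+ q ℕ.* L)
              lem = ℕSolver.solve-∀
      p≤s : p ≤ suc s
      p≤s = subst (_≤ suc s) (sym p≡) (s≤s (ℕ.m≤m+n p-1 q))
      p≤t : p ≤ suc t
      p≤t = subst (_≤ suc t) (sym p≡) (s≤s (ℕ.m≤m+n p-1 ρ))
      s≤ : suc s ℕ.+ p ≤ 2 ℕ.* X
      s≤ = ℕ.≤-trans (by≤ 0 (ℕ./-monoˡ-≤ L (ℕ.<⇒≤ D<m) ⊕ =≤ (sym p≡)) (lem p-1 q p M)) ≤2X
        where lem : ∀ r q p M → suc (r ℕ.+ q) ℕ.+ p ℕ.+ (M ℕ.+ p) ℕ.+ 0 ≡ M ℕ.+ 2 ℕ.* p ℕ.+ (q ℕ.+ suc r)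
              lem = ℕSolver.solve-∀
      t≤ : suc t ℕ.+ p ≤ 2 ℕ.* Y
      t≤ = by≤ 1 (ℕ.m%n<n D L ⊕ =≤ (sym p≡) ⊕ ≥= 2Y≡) (lem p-1 ρ p L Y)
        where lem : ∀ r q p L Y → suc (r ℕ.+ q) ℕ.+ p ℕ.+ (L ℕ.+ (p ℕ.+ (Y ℕ.+ Y))) ℕ.+ 1 ≡ 2 ℕ.* Y ℕ.+ (suc q ℕ.+ (suc r ℕ.+ (L ℕ.+ 2 ℕ.* p)))
              lem = ℕSolver.solve-∀

    base≤m : base ≤ m
    base≤m = ℕ.≤-trans (by≤ 0 (p-1≤L ⊕ =≤ refl) (lem L p-1)) (ℕ.≤-trans (ℕ.*-monoʳ-≤ L sp≤M) (ℕ.≤-trans (ℕ.≤-reflexive (ℕ.*-comm L M)) (ℕ.m/n*n≤m m L)))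
      where
      p≤Y : p ≤ Y
      p≤Y = ℕ.*-cancelˡ-≤ 2 (by≤ L (=≤ (sym 2Y≡)) (lem p L Y))
        where lem : ∀ p L Y → 2 ℕ.* p ℕ.+ (Y ℕ.+ Y) ℕ.+ L ≡ 2 ℕ.* Y ℕ.+ (L ℕ.+ 2 ℕ.* p)
              lem = ℕSolver.solve-∀
      p-1≤L : p-1 ≤ L
      p-1≤L = ℕ.≤-trans (ℕ.≤-trans (ℕ.n≤1+n p-1) (ℕ.≤-reflexive (sym p≡))) (ℕ.≤-trans p≤Y Y≤L)
      sp≤M : suc p-1 ≤ M
      sp≤M = ℕ.≤-trans (ℕ.≤-reflexive (sym p≡)) (ℕ.≤-trans (ℕ.*-cancelˡ-≤ 2 (ℕ.≤-trans (ℕ.m≤n+m (2 ℕ.* p) M) ≤2X)) X≤M)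
      lem : ∀ L r → L ℕ.* r ℕ.+ r ℕ.+ (L ℕ.+ 0) ℕ.+ 0 ≡ L ℕ.* suc r ℕ.+ (r ℕ.+ 0)
      lem = ℕSolver.solve-∀

    -- Since base ≤ m, the window of m consecutive sums lies below 2m, so it contains n or n + m.
    sums-exist : ∀ n → n < m → ∃ λ u → Sum n u ⊎ Sum (n ℕ.+ m) u
    sums-exist n n<m with base ℕ.≤? n
    ... | yes le = let (u , S) = window n le (ℕ.<-≤-trans n<m (ℕ.m≤n+m m base)) in u , inj₁ S
    ... | no gt  = let (u , S) = window (n ℕ.+ m) (ℕ.≤-trans base≤m (ℕ.m≤n+m m n)) (ℕ.+-monoˡ-< m (ℕ.≰⇒> gt)) in u , inj₂ S

    fits : ∀ {k x y} → InBox k x y → L ℕ.* x ℕ.+ y < m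
    fits {k} {x} {y} b = begin-strict
      L ℕ.* x ℕ.+ y   <⟨ ℕ.+-monoʳ-< (L ℕ.* x) (ℕ.<-≤-trans (b .y<) Y≤L) ⟩
      L ℕ.* x ℕ.+ L   ≡⟨ lem L x ⟩
      suc x ℕ.* L     ≤⟨ ℕ.*-monoˡ-≤ L (ℕ.≤-trans (b .x<) X≤M) ⟩
      M ℕ.* L         ≤⟨ ℕ.m/n*n≤m m L ⟩
      m ∎
      where
      open ℕ.≤-Reasoning
      lem : ∀ L x → L ℕ.* x ℕ.+ L ≡ suc x ℕ.* L
      lem = ℕSolver.solve-∀

-- From coded integers to subsets of the residues modulo m

module RuzsaSets where
  open Bounds
  open QuadraticResidues
  open SlotCounting
  open DigitSums
  open PrimeGaps
  open LinearArithmetic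
  open import Data.Nat
  open import Data.Nat.Properties
  open import Data.Nat.DivMod
  open import Data.Nat.Divisibility using (divides; _∣?_; _∣_; n∣m*n)
  open import Data.Nat.Primality using (Prime; prime⇒irreducible)
  open import Data.Nat.Tactic.RingSolver using (solve-∀)
  open import Data.Integer using (ℤ)
  open import Data.Fin using (Fin; suc; toℕ; fromℕ<)
  open import Data.Fin.Properties using (any?; toℕ<n; toℕ-fromℕ<; toℕ-injective)
  open import Data.Fin.Subset using (Subset; _∈_)
  open import Data.Fin.Subset.Properties using (_∈?_)
  open import Data.Vec using (tabulate)
  open import Data.Vec.Properties using (lookup⇒[]=; []=⇒lookup; lookup∘tabulate)
  open import Data.List using (List; cartesianProduct; allFin)
  open import Data.List.Relation.Unary.All.Properties using (all-filter)
  open import Data.List.Relation.Unary.Unique.Propositional.Properties using (allFin⁺; cartesianProduct⁺; filter⁺)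
  open import Data.List.Membership.Propositional using () renaming (_∈_ to _∈ˡ_)
  open import Data.List.Membership.Propositional.Properties using (∈-filter⁺; ∈-cartesianProduct⁺; ∈-allFin; ∈-length)
  open import Data.Product using (∃; _×_; _,_; proj₁; proj₂)
  open import Data.Sum using (_⊎_; inj₁; inj₂; [_,_]′)
  open import Function using (_∘_; case_of_)
  open import Relation.Nullary using (¬_; Dec; yes; no; does; contradiction)
  open import Relation.Nullary.Decidable using (_×-dec_; _⊎-dec_; toWitness; dec-true)
  open import Relation.Binary.PropositionalEquality

  -- For a, b < m the congruence modulo m leaves only the integers n and n + m, so no reduction
  -- appears from here on.
  SumsTo : ∀ {m} → (Fin m → Set) → Fin m → Fin m × Fin m → Set
  SumsTo {m} P n (a , b) = P a × P b × (toℕ a + toℕ b ≡ toℕ n ⊎ toℕ a + toℕ b ≡ toℕ n + m)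

  addMod⇒ : ∀ {m} (a b n : Fin m) → addMod a b ≡ toℕ n → toℕ a + toℕ b ≡ toℕ n ⊎ toℕ a + toℕ b ≡ toℕ n + m
  addMod⇒ {m@(suc _)} a b n eq with toℕ a + toℕ b <? m
  ... | yes lt = inj₁ (trans (sym (m<n⇒m%n≡m lt)) eq)
  ... | no ≥m = inj₂ (begin
      c          ≡⟨ m∸n+n≡m (≮⇒≥ ≥m) ⟨
      c ∸ m + m  ≡⟨ cong (_+ m) (m<n⇒m%n≡m c-m<m) ⟨
      (c ∸ m) % m + m ≡⟨ cong (_+ m) (trans (m≤n⇒[n∸m]%m≡n%m (≮⇒≥ ≥m)) eq) ⟩
      toℕ n + m  ∎)
    where
    open ≡-Reasoning
    c = toℕ a + toℕ b
    c-m<m : c ∸ m < m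
    c-m<m = +-cancelʳ-< m (c ∸ m) m (subst (_< m + m) (sym (m∸n+n≡m (≮⇒≥ ≥m))) (+-mono-< (toℕ<n a) (toℕ<n b)))

  ⇒addMod : ∀ {m} (a b n : Fin m) → toℕ a + toℕ b ≡ toℕ n ⊎ toℕ a + toℕ b ≡ toℕ n + m → addMod a b ≡ toℕ n
  ⇒addMod {m@(suc _)} a b n (inj₁ eq) = trans (cong (_% m) eq) (m<n⇒m%n≡m (toℕ<n n))
  ⇒addMod {m@(suc _)} a b n (inj₂ eq) = trans (cong (_% m) eq) (trans ([m+n]%n≡m%n (toℕ n) m) (m<n⇒m%n≡m (toℕ<n n)))

  module _ {m r : ℕ} (P : Fin m → Set) (P? : ∀ a → Dec (P a)) where

    comprehension : Subset m
    comprehension = tabulate (does ∘ P?)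

    ∈-comprehension⁺ : ∀ {a} → P a → a ∈ comprehension
    ∈-comprehension⁺ {a} pa = lookup⇒[]= a comprehension (trans (lookup∘tabulate (does ∘ P?) a) (dec-true (P? a) pa))

    ∈-comprehension⁻ : ∀ {a} → a ∈ comprehension → P a
    ∈-comprehension⁻ {a} a∈ with P? a | trans (sym (lookup∘tabulate (does ∘ P?) a)) ([]=⇒lookup a∈)
    ... | yes pa | _  = pa
    ... | no _   | ()

    ruzsa-admissible : (∀ n → Bounded r (SumsTo P n)) → (∀ n → ∃ (SumsTo P n)) → RuzsaAdmissible m r
    ruzsa-admissible bounded exists = comprehension , λ n → lower n , upper n
      where
      Counted : Fin m → Fin m × Fin m → Set
      Counted n p = proj₁ p ∈ comprehension × proj₂ p ∈ comprehension × addMod (proj₁ p) (proj₂ p) ≡ toℕ n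
      counted? : ∀ n p → Dec (Counted n p)
      counted? n p = (proj₁ p ∈? comprehension) ×-dec ((proj₂ p ∈? comprehension) ×-dec (addMod (proj₁ p) (proj₂ p) ≟ toℕ n))
      pairs : List (Fin m × Fin m)
      pairs = cartesianProduct (allFin m) (allFin m)
      lower : ∀ n → 1 ≤ σ comprehension n
      lower n with exists n
      ... | (a , b) , pa , pb , eq = ∈-length (∈-filter⁺ (counted? n) (∈-cartesianProduct⁺ (∈-allFin a) (∈-allFin b))
              (∈-comprehension⁺ pa , ∈-comprehension⁺ pb , ⇒addMod a b n eq))
      upper : ∀ n → σ comprehension n ≤ r
      upper n = bounded-length (filter⁺ (counted? n) (cartesianProduct⁺ (allFin⁺ m) (allFin⁺ m)))
        (all-filter (counted? n) pairs)
        (bounded-⊆ (λ { {a , b} (a∈ , b∈ , eq) → ∈-comprehension⁻ a∈ , ∈-comprehension⁻ b∈ , addMod⇒ a b n eq }) (bounded n))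

  -- Digits in base 96: n is its remainder plus a multiple of 96. For m ≤ 96² = 9216 this set has at
  -- most 96 + 96 elements, and the first summand determines the second.
  small-admissible : ∀ m → m ≤ 9216 → RuzsaAdmissible m 192
  small-admissible m m≤ = ruzsa-admissible P P? bounded exists
    where
    P : Fin m → Set
    P a = toℕ a < 96 ⊎ 96 ∣ toℕ a
    P? : ∀ a → Dec (P a)
    P? a = (toℕ a <? 96) ⊎-dec (96 ∣? toℕ a)
    bounded : ∀ n → Bounded 192 (SumsTo P n)
    bounded n = bounded-map proj₁ determined (λ { (pa , _) → pa }) (bounded-∪ (λ _ pa → pa)
        (record { code = λ _ lt → fromℕ< lt
                ; injective = λ la lb eq → toℕ-injective (trans (sym (toℕ-fromℕ< la)) (trans (cong toℕ eq) (toℕ-fromℕ< lb))) })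
        (record { code = λ a _ → fromℕ< (m<n*o⇒m/o<n {toℕ a} {96} {96} (≤-trans (toℕ<n a) m≤))
                ; injective = λ {a} {b} da db eq → toℕ-injective (trans (sym (m/n*n≡m da)) (trans (cong (_* 96)
                    (trans (sym (toℕ-fromℕ< _)) (trans (cong toℕ eq) (toℕ-fromℕ< _)))) (m/n*n≡m db))) }))
      where
      determined : ∀ {u v} → SumsTo P n u → SumsTo P n v → proj₁ u ≡ proj₁ v → u ≡ v
      determined {a , b} {_ , b′} (_ , _ , e) (_ , _ , e′) refl = cong (a ,_) (toℕ-injective (same e e′))
        where
        apart : ∀ {b b′ : Fin m} → toℕ a + toℕ b ≡ toℕ n → toℕ a + toℕ b′ ≢ toℕ n + m
        apart {b} {b′} e e′ = <⇒≱ (toℕ<n b′) (by≤ (toℕ b) (=≤ (sym e′) ⊕ =≤ e) (lem (toℕ a) (toℕ b) (toℕ b′) (toℕ n) m))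
          where lem : ∀ a b c n m → m + (a + c + n) + b ≡ c + (n + m + (a + b))
                lem = solve-∀
        same : _ → _ → toℕ b ≡ toℕ b′
        same (inj₁ e) (inj₁ e′) = +-cancelˡ-≡ (toℕ a) _ _ (trans e (sym e′))
        same (inj₁ e) (inj₂ e′) = contradiction e′ (apart {b} {b′} e)
        same (inj₂ e) (inj₁ e′) = contradiction e (apart {b′} {b} e′)
        same (inj₂ e) (inj₂ e′) = +-cancelˡ-≡ (toℕ a) _ _ (trans e (sym e′))
    exists : ∀ n → ∃ (SumsTo P n)
    exists n = (fromℕ< r<m , fromℕ< q<m) ,
        inj₁ (subst (_< 96) (sym (toℕ-fromℕ< r<m)) (m%n<n (toℕ n) 96)) ,
        inj₂ (subst (96 ∣_) (sym (toℕ-fromℕ< q<m)) (n∣m*n (toℕ n / 96))) ,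
        inj₁ (trans (cong₂ _+_ (toℕ-fromℕ< r<m) (toℕ-fromℕ< q<m)) (sym (m≡m%n+[m/n]*n (toℕ n) 96)))
      where
      r<m : toℕ n % 96 < m
      r<m = ≤-<-trans (m%n≤m (toℕ n) 96) (toℕ<n n)
      q<m : toℕ n / 96 * 96 < m
      q<m = ≤-<-trans (m/n*n≤m (toℕ n) 96) (toℕ<n n)

  module Admissibility (p : ℕ) (pp : Prime p) (19<p : 19 < p) (h : ℕ) (p≡ : p ≡ 1 + (h + h)) (2≤h : 2 ≤ h)
                       (g : ℤ) (adm : Residues.Good.Admissible p pp 19<p g)
                       (L Y : ℕ) .{{_ : NonZero L}} (2Y≡ : Y + Y ≡ L + 2 * p) (Y≤3p : Y ≤ 3 * p) (Y≤L : Y ≤ L)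
                       (m X : ℕ) (X≤4p : X ≤ 4 * p) (X≤M : X ≤ m / L)
                       (2X≤ : 2 * X ≤ m / L + 3 * p) (≤2X : m / L + 2 * p ≤ 2 * X) where
    open Counting p pp 19<p h p≡ 2≤h g adm using (Point)
    open Construct p pp 19<p h p≡ 2≤h g adm L Y 2Y≡ Y≤3p Y≤L m X X≤4p X≤M 2X≤ ≤2X

    -- The curve is quantified away, so a residue on several curves is a single element.
    Coded : Fin m → Set
    Coded a = ∃ λ k → InBox k (toℕ a / L) (toℕ a % L)

    value : Point → ℕ
    value (_ , x , y) = L * x + y

    coded : ∀ {k x y} (b : InBox k x y) → Coded (fromℕ< (fits b))
    coded {k} {x} {y} b = k , subst₂ (InBox k) (proj₁ unique) (proj₂ unique) b
      where unique = div-mod-unique {toℕ (fromℕ< (fits b))} {x} {y} L (sym (toℕ-fromℕ< (fits b))) (<-≤-trans (InBox.y< b) Y≤L)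

    decode : ∀ {a} → Coded a → ∃ λ u → InBox (proj₁ u) (proj₁ (proj₂ u)) (proj₂ (proj₂ u)) × value u ≡ toℕ a
    decode {a} (k , b) = (k , toℕ a / L , toℕ a % L) , b ,
      trans (trans (+-comm (L * (toℕ a / L)) (toℕ a % L)) (cong (toℕ a % L +_) (*-comm L (toℕ a / L)))) (sym (m≡m%n+[m/n]*n (toℕ a) L))

    value-+ : ∀ x y x′ y′ → L * (x + x′) + (y + y′) ≡ L * x + y + (L * x′ + y′)
    value-+ = lem L
      where lem : ∀ L x y x′ y′ → L * (x + x′) + (y + y′) ≡ L * x + y + (L * x′ + y′)
            lem = solve-∀

    bounded : ∀ n → Bounded 192 (SumsTo Coded n)
    bounded n = bounded-rel (λ (u , v) (a , b) → value u ≡ toℕ a × value v ≡ toℕ b)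
      (λ (e₁ , e₂) (f₁ , f₂) → cong₂ _,_ (toℕ-injective (trans (sym e₁) f₁)) (toℕ-injective (trans (sym e₂) f₂)))
      preimage (sums-bound (toℕ n))
      where
      preimage : ∀ ab → SumsTo Coded n ab → ∃ λ uv → (Sum (toℕ n) uv ⊎ Sum (toℕ n + m) uv) × (value (proj₁ uv) ≡ toℕ (proj₁ ab) × value (proj₂ uv) ≡ toℕ (proj₂ ab))
      preimage (a , b) (ca , cb , eq) with decode ca | decode cb
      ... | u@(k , x , y) , bu , eu | v@(k′ , x′ , y′) , bv , ev = (u , v) ,
        [ (λ e → inj₁ (sum bu bv (trans (value-+ x y x′ y′) (trans (cong₂ _+_ eu ev) e)))) ,
          (λ e → inj₂ (sum bu bv (trans (value-+ x y x′ y′) (trans (cong₂ _+_ eu ev) e)))) ]′ eq , eu , ev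

    exists : ∀ n → ∃ (SumsTo Coded n)
    exists n with sums-exist (toℕ n) (toℕ<n n)
    ... | ((k , x , y) , (k′ , x′ , y′)) , S = (fromℕ< (fits (left S)) , fromℕ< (fits (right S))) ,
          coded (left S) , coded (right S) ,
          [ (λ s → inj₁ (trans values (Sum.total s))) , (λ s → inj₂ (trans values (Sum.total s))) ]′ S
      where
      left : ∀ {u} → Sum (toℕ n) u ⊎ Sum (toℕ n + m) u → _
      left = [ Sum.left , Sum.left ]′
      right : ∀ {u} → Sum (toℕ n) u ⊎ Sum (toℕ n + m) u → _
      right = [ Sum.right , Sum.right ]′
      values : toℕ (fromℕ< (fits (left S))) + toℕ (fromℕ< (fits (right S))) ≡ L * (x + x′) + (y + y′)
      values = trans (cong₂ _+_ (toℕ-fromℕ< (fits (left S))) (toℕ-fromℕ< (fits (right S)))) (sym (value-+ x y x′ y′))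

    admissible : RuzsaAdmissible m 192
    admissible = ruzsa-admissible Coded (λ a → any? λ k → inBox? k (toℕ a / L) (toℕ a % L)) bounded exists

  -- Choice of p, L and X

  prime-odd : ∀ p → Prime p → 19 < p → ∃ λ h → p ≡ 1 + (h + h) × 2 ≤ h
  prime-odd p pp 19<p with even-or-odd p
  ... | k , inj₁ refl = case prime⇒irreducible pp (divides k (lem k)) of λ where
      (inj₁ ())
      (inj₂ eq) → contradiction 19<p (subst (λ z → ¬ (19 < z)) eq (λ le → contradiction le λ { (s≤s (s≤s ())) }))
    where lem : ∀ k → k + k ≡ k * 2
          lem = solve-∀
  ... | h , inj₂ refl = h , refl , ≮⇒≥ λ h<2 → <⇒≱ 19<p (≤-trans (s≤s (s≤s⁻¹ h<2 ⊕ s≤s⁻¹ h<2)) (toWitness {a? = 3 ≤? 19} _))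

  -- X is p plus half of M, rounded up. Then 2p + 1 ≤ M gives X ≤ M, and M ≤ 6p gives X ≤ 4p.
  chooseX : ∀ M p → 1 ≤ p → 2 * p + 1 ≤ M → M ≤ 6 * p → ∃ λ X → X ≤ 4 * p × X ≤ M × 2 * X ≤ M + 3 * p × M + 2 * p ≤ 2 * X
  chooseX M p 1≤p lo hi with even-or-odd M
  ... | k , inj₁ refl = k + p ,
      *-cancelˡ-≤ 2 (by≤ 0 hi (l₁ k p)) , *-cancelˡ-≤ 2 (by≤ 1 (lo ⊕ =≤ {k} refl) (l₂ k p)) , by≤ p (=≤ {k} refl) (l₃ k p) , by≤ 0 (=≤ {k} refl) (l₄ k p)
    where
    l₁ : ∀ k p → 2 * (k + p) + 6 * p + 0 ≡ 2 * (4 * p) + (k + k)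
    l₁ = solve-∀
    l₂ : ∀ k p → 2 * (k + p) + (k + k + k) + 1 ≡ 2 * (k + k) + (2 * p + 1 + k)
    l₂ = solve-∀
    l₃ : ∀ k p → 2 * (k + p) + k + p ≡ k + k + 3 * p + k
    l₃ = solve-∀
    l₄ : ∀ k p → k + k + 2 * p + k + 0 ≡ 2 * (k + p) + k
    l₄ = solve-∀
  ... | k , inj₂ refl = suc k + p ,
      by≤ 0 k<3p (l₁ k p) , by≤ 0 p≤k (l₂ k p) , by≤ 0 1≤p (l₃ k p) , by≤ 1 (=≤ {k} refl) (l₄ k p)
    where
    k<3p : k < 3 * p
    k<3p = *-cancelˡ-< 2 k (3 * p) (by≤ 0 hi (l k p))
      where l : ∀ k p → suc (2 * k) + 6 * p + 0 ≡ 2 * (3 * p) + suc (k + k)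
            l = solve-∀
    p≤k : p ≤ k
    p≤k = *-cancelˡ-≤ 2 (by≤ 0 lo (l k p))
      where l : ∀ k p → 2 * p + suc (k + k) + 0 ≡ 2 * k + (2 * p + 1)
            l = solve-∀
    l₁ : ∀ k p → suc k + p + 3 * p + 0 ≡ 4 * p + suc k
    l₁ = solve-∀
    l₂ : ∀ k p → suc k + p + k + 0 ≡ suc (k + k) + p
    l₂ = solve-∀
    l₃ : ∀ k p → 2 * (suc k + p) + p + 0 ≡ suc (k + k) + 3 * p + 1
    l₃ = solve-∀
    l₄ : ∀ k p → suc (k + k) + 2 * p + k + 1 ≡ 2 * (suc k + p) + k
    l₄ = solve-∀

  ≤⇒≤/ : ∀ {k m} L .{{_ : NonZero L}} → k * L ≤ m → k ≤ m / L
  ≤⇒≤/ {k} {m} L le = subst (_≤ m / L) (m*n/n≡m k L) (/-monoˡ-≤ L le)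

  module Scale (m p : ℕ) (pp : Prime p) (19<p : 19 < p) where
    open Residues p pp
    private
      h = proj₁ (prime-odd p pp 19<p)
      p≡ = proj₁ (proj₂ (prime-odd p pp 19<p))
      2≤h = proj₂ (proj₂ (prime-odd p pp 19<p))
      open Odd h p≡ 2≤h
      open Good 19<p renaming (admissible to admissible-multiplier)
      multiplier = admissible-multiplier (proj₁ nonSquare) (proj₂ nonSquare)

    admissible-at : ∀ L Y .{{_ : NonZero L}} → Y + Y ≡ L + 2 * p → Y ≤ 3 * p → Y ≤ L →
                    2 * p + 1 ≤ m / L → m / L ≤ 6 * p → RuzsaAdmissible m 192
    admissible-at L Y 2Y≡ Y≤3p Y≤L lo hi with chooseX (m / L) p (≤-trans (s≤s z≤n) 19<p) lo hi
    ... | X , X≤4p , X≤M , 2X≤ , ≤2X = Admissibility.admissible p pp 19<p h p≡ 2≤h (proj₁ multiplier) (proj₂ multiplier)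
          L Y 2Y≡ Y≤3p Y≤L m X X≤4p X≤M 2X≤ ≤2X

    -- Base 2p, with Y = 2p, serves as long as m / 2p ≤ 6p. Beyond that m exceeds 12p², enough for
    -- base 4p with Y = 3p, which reaches 24p².
    admissible-between : (2 * p + 1) * (2 * p) ≤ m → m < 24 * (p * p) → RuzsaAdmissible m 192
    admissible-between lo hi with m / (2 * p) ≤? 6 * p
      where instance _ = m*n≢0 2 p
    ... | yes M≤6p = admissible-at (2 * p) (2 * p) refl (*-monoˡ-≤ p (≤ᵇ⇒≤ 2 3 _)) ≤-refl (≤⇒≤/ (2 * p) lo) M≤6p
      where instance _ = m*n≢0 2 p
    ... | no M≰6p = admissible-at (4 * p) (3 * p) (l₀ p) ≤-refl (*-monoˡ-≤ p (≤ᵇ⇒≤ 3 4 _))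
        (≤⇒≤/ (4 * p) (≤-trans (by≤ (2 * (p * p)) (2 ⊛ p≤pp) (l₁ p)) big)) (s≤s⁻¹ (m<n*o⇒m/o<n (<-≤-trans hi (by≤ (4 * p) (=≤ {p} refl) (l₂ p)))))
      where
      instance
        _ = m*n≢0 2 p
        _ = m*n≢0 4 p
      p≤pp : p ≤ p * p
      p≤pp = m≤m*n p p
      big : suc (6 * p) * (2 * p) ≤ m
      big = ≤-trans (*-monoˡ-≤ (2 * p) (≰⇒> M≰6p)) (m/n*n≤m m (2 * p))
      l₀ : ∀ p → 3 * p + 3 * p ≡ 4 * p + 2 * p
      l₀ = solve-∀
      l₁ : ∀ p → (2 * p + 1) * (4 * p) + 2 * (p * p) + 2 * (p * p) ≡ suc (6 * p) * (2 * p) + 2 * p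
      l₁ = solve-∀
      l₂ : ∀ p → 24 * (p * p) + p + 4 * p ≡ suc (6 * p) * (4 * p) + p
      l₂ = solve-∀

  large-admissible : ∀ m → 9216 < m → RuzsaAdmissible m 192
  large-admissible m 9216<m = case primeGap n 19≤n of λ where
      (p , pp , n<p , 5p≤12n) → Scale.admissible-between m p pp (≤-<-trans 19≤n n<p) (lower p 5p≤12n) (upper p n<p)
    where
    open ≤-Reasoning
    root = floorSqrt (m / 24)
    n = proj₁ root
    m< : m < suc n * suc n * 24
    m< = begin-strict
      m                     ≡⟨ m≡m%n+[m/n]*n m 24 ⟩
      m % 24 + m / 24 * 24  <⟨ +-monoˡ-< (m / 24 * 24) (m%n<n m 24) ⟩
      suc (m / 24) * 24     ≤⟨ *-monoˡ-≤ 24 (proj₂ (proj₂ root)) ⟩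
      suc n * suc n * 24    ∎
    19≤n : 19 ≤ n
    19≤n = ≮⇒≥ λ n<19 → <⇒≱ 9216<m (begin
      m                   ≤⟨ <⇒≤ m< ⟩
      suc n * suc n * 24  ≤⟨ *-monoˡ-≤ 24 (*-mono-≤ n<19 n<19) ⟩
      19 * 19 * 24        ≤⟨ ≤ᵇ⇒≤ (19 * 19 * 24) 9216 _ ⟩
      9216                ∎)
    upper : ∀ p → n < p → m < 24 * (p * p)
    upper p n<p = begin-strict
      m                   <⟨ m< ⟩
      suc n * suc n * 24  ≤⟨ *-monoˡ-≤ 24 (*-mono-≤ n<p n<p) ⟩
      p * p * 24          ≡⟨ *-comm (p * p) 24 ⟩
      24 * (p * p)        ∎
    -- 4p² is at most 23.04 n², and the remaining 0.96 n² covers 2p ≤ 4.8 n as soon as n ≥ 5.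
    lower : ∀ p → 5 * p ≤ 12 * n → (2 * p + 1) * (2 * p) ≤ m
    lower p 5p≤12n = begin
      (2 * p + 1) * (2 * p)  ≤⟨ *-cancelˡ-≤ 25 (by≤ 0
                                  (4 ⊛ *-mono-≤ 5p≤12n 5p≤12n ⊕ 10 ⊛ 5p≤12n ⊕ 24 ⊛ *-monoˡ-≤ n (≤-trans (≤ᵇ⇒≤ 5 19 _) 19≤n))
                                  (lem p n)) ⟩
      24 * (n * n)           ≤⟨ *-monoʳ-≤ 24 (proj₁ (proj₂ root)) ⟩
      24 * (m / 24)          ≡⟨ *-comm 24 (m / 24) ⟩
      m / 24 * 24            ≤⟨ m/n*n≤m m 24 ⟩
      m                      ∎
      where
      lem : ∀ p n → 25 * ((2 * p + 1) * (2 * p)) + (4 * (12 * n * (12 * n)) + (10 * (12 * n) + 24 * (n * n))) + 0 ≡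
                    25 * (24 * (n * n)) + (4 * (5 * p * (5 * p)) + (10 * (5 * p) + 24 * (5 * n)))
      lem = solve-∀

  ruzsaNumber≤192 : ∀ m → RuzsaNumberAtMost m 192
  ruzsaNumber≤192 m = 192 , s≤s z≤n , ≤-refl , (case m ≤? 9216 of λ where
    (yes m≤) → small-admissible m m≤
    (no m≰)  → large-admissible m (≰⇒> m≰))

open RuzsaSets using (ruzsaNumber≤192)

theorem1 : ∀ (m : ℕ) → 1 ≤ m → RuzsaNumberAtMost m 192
theorem1 m _ = ruzsaNumber≤192 m
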